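{- The algorithm of Khuller et al. described in the context, run with threshold $k=24$, is a $\frac{35}{23}$-approximation algorithm ($\frac{35}{23}\approx 1.522$) for the SCSS problem in symmetric unweighted digraphs; that is, for every strongly connected symmetric unweighted digraph it returns a strongly connected spanning subgraph having at most $\frac{35}{23}$ times the minimum possible number of edges.
   Context: **SCSS problem.** Given a strongly connected unweighted directed graph $D$, find a strongly connected spanning subgraph of $D$ with the minimum number of (directed) edges. A digraph is symmetric if, whenever $(u,v)$ is an edge, $(v,u)$ is also an edge. **Algorithm (Khuller et al.), with a constant threshold $k$.** Given a strongly connected digraph: while the current graph contains a directed cycle of length at least $k$, find such a cycle, contract it (recording its edges), and continue with the contracted graph. After no such cycle exists, repeatedly find a longest directed cycle in the current graph, contract it (recording its edges), and continue. When the current graph has only cycles of length at most $3$, solve the SCSS problem optimally on it. Return all edges of the contracted cycles together with the edges of the optimal solution of the final graph. Contracted graphs remain strongly connected. -}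

module Defs where

open import Level using (0ℓ)
open import Data.Nat using (ℕ; _≤_; _<_)
open import Data.Fin using (Fin)
open import Data.Fin.Properties using (_≟_; any?)
open import Data.List using (List; []; _∷_; _∷ʳ_; _++_; length; zip; filter; allFin; cartesianProduct)
open import Data.List.Membership.Propositional using (_∈_)
import Data.List.Membership.DecPropositional as DecMembership
open import Data.List.Relation.Unary.All using (All)
open import Data.List.Relation.Unary.Unique.Propositional using (Unique)
open import Data.List.Relation.Binary.Pointwise using (Pointwise)
open import Data.Product using (_×_; _,_; ∃₂; uncurry; map)
open import Data.Product.Properties using (≡-dec)
open import Data.Sum using (_⊎_)
open import Function.Bundles using (_⇔_)
open import Function.Definitions using (Surjective)
open import Relation.Binary.Core using (Rel; _⇒_)
open import Relation.Binary.Definitions using (Decidable)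
open import Relation.Binary.Construct.Closure.ReflexiveTransitive using (Star)
open import Relation.Binary.PropositionalEquality using (_≡_; _≢_)
open import Relation.Nullary using (¬_)
open import Relation.Nullary.Decidable using (¬?; _×-dec_)

-- Loops are allowed but irrelevant: they lie on no cycle of length ≥ 2 and in
-- no minimum strongly connected spanning subgraph.
record Digraph (n : ℕ) : Set₁ where
  field
    Edge  : Rel (Fin n) 0ℓ
    edge? : Decidable Edge

open Digraph public

Arc : ℕ → Set
Arc n = Fin n × Fin n

arcs : ∀ {n} → Digraph n → List (Arc n)
arcs {n} D = filter (λ (u , v) → edge? D u v) (cartesianProduct (allFin n) (allFin n))

size : ∀ {n} → Digraph n → ℕ
size D = length (arcs D)

fromArcs : ∀ {n} → List (Arc n) → Digraph n
fromArcs F .Edge  u v = (u , v) ∈ F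
fromArcs F .edge? u v = DecMembership._∈?_ (≡-dec _≟_ _≟_) (u , v) F

StronglyConnected : ∀ {n} → Digraph n → Set
StronglyConnected D = ∀ u v → Star (Edge D) u v

-- A subgraph on the same vertex type is automatically spanning.
IsSCSS : ∀ {n} → Digraph n → Digraph n → Set
IsSCSS D H = (Edge H ⇒ Edge D) × StronglyConnected H

IsMinimumSCSS : ∀ {n} → Digraph n → Digraph n → Set₁
IsMinimumSCSS D H = IsSCSS D H × (∀ H′ → IsSCSS D H′ → size H ≤ size H′)

-- A cycle v₁ → v₂ → … → vₗ → v₁ is given by the list of its l vertices;
-- it has l arcs as well, so its length is the length of the list.
cycleArcs : ∀ {n} → List (Fin n) → List (Arc n)
cycleArcs []       = []
cycleArcs (v ∷ vs) = zip (v ∷ vs) (vs ∷ʳ v)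

record IsCycle {n} (D : Digraph n) (C : List (Fin n)) : Set where
  field
    nonEmpty : C ≢ []
    distinct : Unique C
    closed   : All (uncurry (Edge D)) (cycleArcs C)

IsLongestCycle : ∀ {n} → Digraph n → List (Fin n) → Set
IsLongestCycle D C = IsCycle D C × (∀ C′ → IsCycle D C′ → length C′ ≤ length C)

-- The quotient map identifying the vertices of C with each other, and no
-- other distinct vertices.  The names of the new vertices are arbitrary.
record Contraction {n} (C : List (Fin n)) (m : ℕ) : Set where
  field
    π          : Fin n → Fin m
    surjective : Surjective _≡_ _≡_ π
    kernel     : ∀ u v → (π u ≡ π v) ⇔ (u ≡ v ⊎ (u ∈ C × v ∈ C))

open Contraction public using (π)

-- Loops created by the contraction are deleted and parallel arcs are merged.
contracted : ∀ {n m} {C : List (Fin n)} → Digraph n → Contraction C m → Digraph m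
contracted D q .Edge a b =
  a ≢ b × ∃₂ λ u v → Edge D u v × π q u ≡ a × π q v ≡ b
contracted D q .edge? a b =
  ¬? (a ≟ b) ×-dec
  any? λ u → any? λ v → edge? D u v ×-dec (π q u ≟ a) ×-dec (π q v ≟ b)

-- Reading arcs of the contracted graph as arcs of the graph before the
-- contraction: each one is replaced by some arc that it comes from.
Lifts : ∀ {n m} {C : List (Fin n)} → Digraph n → Contraction C m →
        List (Arc n) → List (Arc m) → Set
Lifts D q = Pointwise λ e e′ → uncurry (Edge D) e × map (π q) (π q) e ≡ e′

-- The algorithm makes arbitrary choices (which cycle, which lift, which optimal
-- solution), so it is given as a relation between an input and a returned
-- collection of arcs.

-- Phase₂ D F: the second part of the algorithm, started on D, may return F.
data Phase₂ : ∀ {n} → Digraph n → List (Arc n) → Set₁ where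
  solve : ∀ {n} {D H : Digraph n} →
          (∀ C → IsCycle D C → length C ≤ 3) →
          IsMinimumSCSS D H →
          Phase₂ D (arcs H)
  contract : ∀ {n m} {D : Digraph n} {C F F′} →
             IsLongestCycle D C → 3 < length C →
             (q : Contraction C m) →
             Phase₂ (contracted D q) F′ → Lifts D q F F′ →
             Phase₂ D (cycleArcs C ++ F)

-- Khuller k D F: the algorithm with threshold k, started on D, may return F.
data Khuller (k : ℕ) : ∀ {n} → Digraph n → List (Arc n) → Set₁ where
  contract : ∀ {n m} {D : Digraph n} {C F F′} →
             IsCycle D C → k ≤ length C →
             (q : Contraction C m) →
             Khuller k (contracted D q) F′ → Lifts D q F F′ →
             Khuller k D (cycleArcs C ++ F)
  phase₂ : ∀ {n} {D : Digraph n} {F} →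
           (∀ C → IsCycle D C → ¬ (k ≤ length C)) →
           Phase₂ D F →
           Khuller k D F

-- Let C be a longest cycle, of length at least 3, of a symmetric digraph D and let O be a strongly
-- connected spanning subgraph.  Then O has at least two arcs with both ends in C: otherwise O stays
-- (weakly) connected without them, and a T-join together with Thomason's lollipop argument produces a
-- cycle longer than C.  So every contraction in the second phase lowers the optimum by at least 2.
-- Charging 24/23 per removed vertex and 11/23 per lost arc of the optimum pays for every contracted cycle:
-- in the first phase since 23 l ≤ 24 (l - 1) for l ≥ 24, in the second since 23 l ≤ 24 (l - 1) + 22 for
-- l ≥ 2.  The final graph on n vertices is paid for because its optimum is at most 2 (n - 1).  As the
-- optimum is at least n - 1, with room to spare in the constants, the total is at most 35/23 of it.
module Submission where

open import Level using (Level; 0ℓ)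
import Data.Bool as Bool
open import Data.Bool using (Bool; true; false; _∧_; _xor_; not)
open import Data.Bool.Properties
  using (xor-assoc; xor-comm; xor-same; xor-identityʳ; xor-∧-commutativeRing; ∧-comm; ∧-zeroʳ; ∧-identityʳ; ¬-not)
open import Algebra.Bundles using (CommutativeRing)
open import Algebra.Properties.CommutativeSemigroup
  (CommutativeRing.+-commutativeSemigroup xor-∧-commutativeRing) using (interchange)
open import Data.Fin using (Fin; zero; suc)
open import Data.Fin.Properties using (_≟_; all?)
open import Data.List
  using (List; []; _∷_; _∷ʳ_; _++_; _ʳ++_; length; zip; filter; allFin; cartesianProduct; cartesianProductWith;
         reverse; last; lookup)
import Data.List as List
open import Data.List.Membership.Propositional using (_∈_; _∉_; find; lose)
open import Data.List.Membership.Propositional.Properties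
import Data.List.Membership.DecPropositional as DecMembership
open import Data.List.Properties
  using (++-assoc; reverse-involutive; reverse-++; unfold-reverse; ʳ++-defn; length-++; length-map; length-tabulate)
import Data.List.Properties as List
open import Data.List.Relation.Binary.Permutation.Propositional using (_↭_; ↭-sym; ↭⇒↭ₛ)
open import Data.List.Relation.Binary.Permutation.Propositional.Properties using (∈-resp-↭; ++⁺ʳ; ↭-reverse)
open import Data.List.Relation.Binary.Permutation.Setoid.Properties using (Unique-resp-↭)
open import Data.List.Relation.Binary.Pointwise using ([]; _∷_; Pointwise-length)
open import Data.List.Relation.Binary.Subset.Propositional using (_⊆_)
open import Data.List.Relation.Unary.All as All using (All; []; _∷_)
open import Data.List.Relation.Unary.All.Properties using (¬Any⇒All¬; all-filter)
open import Data.List.Relation.Unary.AllPairs using ([]; _∷_)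
open import Data.List.Relation.Unary.Any as Any using (here; there)
open import Data.List.Relation.Unary.Any.Properties using (lookup-index)
open import Data.List.Relation.Unary.Linked as Linked using (Linked; []; [-]; _∷_; linked?)
import Data.List.Relation.Unary.Linked.Properties as Linked
import Data.List.Relation.Unary.Unique.DecPropositional as DecUnique
open import Data.List.Relation.Unary.Unique.Propositional using (Unique)
import Data.List.Relation.Unary.Unique.Propositional.Properties as Unique
open import Data.Maybe using (Maybe; just; nothing)
import Data.Maybe.Properties as Maybe
open import Data.Maybe.Relation.Binary.Connected using (Connected; just)
open import Data.Nat using (ℕ; zero; suc; _+_; _*_; _≤_; _<_; z≤n; s≤s; s≤s⁻¹; _≤?_)
open import Data.Nat.Induction using (Acc; acc; <-wellFounded)
open import Data.Nat.Properties
  using (≤-antisym; ≤-trans; ≤-reflexive; <-irrefl; ≰⇒>; suc-injective; +-suc; +-comm; +-mono-≤; +-monoˡ-≤;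
         +-monoʳ-≤; *-monoʳ-≤; +-cancelʳ-≤; m≤m+n; ≤-totalOrder; module ≤-Reasoning)
open import Data.List.Extrema ≤-totalOrder
  using (argmin; argmax; f[argmin]≤f[xs]; f[xs]≤f[argmax]; argmin-all; argmax-all)
open import Data.Nat.Tactic.RingSolver using (solve-∀)
open import Data.Product using (∃; ∃₂; _×_; _,_; proj₁; proj₂; uncurry; map; map₁)
import Data.Product.Properties as Product
open import Data.Sum using (_⊎_; inj₁; inj₂; [_,_]′; swap)
import Data.Sum as Sum
open import Function using (_∘_; case_of_; id)
open import Function.Bundles using (Equivalence; mk⇔)
open import Relation.Binary.Core using (Rel)
open import Relation.Binary.Construct.Closure.ReflexiveTransitive using (Star; ε; _◅_; _◅◅_; kleisliStar)
import Relation.Binary.Construct.Closure.ReflexiveTransitive as Star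
open import Relation.Binary.Definitions using (Decidable; DecidableEquality; Symmetric)
open import Relation.Binary.PropositionalEquality hiding (J)
open import Relation.Nullary using (¬_; contradiction; yes; no)
open import Relation.Nullary.Decidable
  using (Dec; does; dec-true; dec-false; decidable-stable; map′; ¬?; _×-dec_; _⊎-dec_)
open import Relation.Unary using (Pred)
import Relation.Unary as Unary
open import Defs

-- All counting is modulo 2: sums of Booleans under `_xor_` over explicit finite lists. A T-join f
-- with odd set C, up to w, exists as soon as the edges T connect the graph: add up one walk to w
-- from each vertex of C. A cycle has even degrees, so in g = C + f the vertices of C other than w
-- are odd and those off C even. Under exactly this parity, the number of paths that start next to
-- w, avoid w, cover the rest of C and end at v is even. C itself gives one such path, hence there
-- is another. As T has no edge inside C, the graph g has no chord of C, so the other path must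
-- leave C and closes up to a longer cycle.
--
-- One arc inside C can be bypassed by strong connectivity; the argument stops at two, since an
-- antiparallel pair can be the only link between two parts of O.
--
-- A threshold k yields a charge of k / (k - 1) per removed vertex, here 24/23. The charge per arc
-- comes from bidirected trees as final graphs: there the optimum is 2 (n - 1) and nothing can be
-- saved, so 2 * 23 = 24 + 2 * 11 is needed.

private
  variable
    a ℓ ℓ′ : Level
    A B : Set a

-- Duplicate-free lists and the enumeration of short lists

does-true⇒ : ∀ {P : Set a} (P? : Dec P) → does P? ≡ true → P
does-true⇒ (yes p) _ = p

-- Pigeonhole: the head of `xs` is cut out of `ys` at one occurrence, and uniqueness keeps the tail
-- of `xs` inside what remains.
unique-⊆⇒length≤ : {xs ys : List A} → Unique xs → xs ⊆ ys → length xs ≤ length ys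
unique-⊆⇒length≤ {xs = []} _ _ = z≤n
unique-⊆⇒length≤ {xs = x ∷ xs} u@(_ ∷ uxs) xs⊆ys with ∈-∃++ (xs⊆ys (here refl))
... | as , bs , refl = ≤-trans (s≤s (unique-⊆⇒length≤ uxs xs⊆as++bs)) (≤-reflexive (sym length-insert))
  where
  length-insert : length (as ++ x ∷ bs) ≡ suc (length (as ++ bs))
  length-insert = trans (length-++ as) (trans (+-suc _ _) (cong suc (sym (length-++ as))))

  xs⊆as++bs : xs ⊆ as ++ bs
  xs⊆as++bs z∈xs with ∈-++⁻ as (xs⊆ys (there z∈xs))
  ... | inj₁ z∈as = ∈-++⁺ˡ z∈as
  ... | inj₂ (here refl) = contradiction z∈xs (Unique.Unique[x∷xs]⇒x∉xs u)
  ... | inj₂ (there z∈bs) = ∈-++⁺ʳ as z∈bs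

unique⇒length≤n : ∀ {n} {xs : List (Fin n)} → Unique xs → length xs ≤ n
unique⇒length≤n u = ≤-trans (unique-⊆⇒length≤ u (λ {x} _ → ∈-allFin x)) (≤-reflexive (length-tabulate _))

unique-⊆-length≥⇒⊇ : DecidableEquality A → {xs ys : List A} → Unique xs → Unique ys →
                     xs ⊆ ys → length ys ≤ length xs → ys ⊆ xs
unique-⊆-length≥⇒⊇ _≟_ {xs} uxs uys xs⊆ys ys≤xs {y} y∈ys with y ∈? xs
  where open DecMembership _≟_ using (_∈?_)
... | yes y∈xs = y∈xs
... | no  y∉xs = contradiction
  (≤-trans (unique-⊆⇒length≤ (¬Any⇒All¬ _ y∉xs ∷ uxs) λ { (here refl) → y∈ys ; (there z∈xs) → xs⊆ys z∈xs }) ys≤xs)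
  (<-irrefl refl)

-- Every duplicate-free list of vertices, hence every path and cycle, occurs in `listsUpTo n n`,
-- which serves as the range of sums and searches.
listsUpTo : ∀ n → ℕ → List (List (Fin n))
listsUpTo n zero    = [] ∷ []
listsUpTo n (suc k) = [] ∷ cartesianProductWith _∷_ (allFin n) (listsUpTo n k)

∈-listsUpTo : ∀ {n k} {xs : List (Fin n)} → length xs ≤ k → xs ∈ listsUpTo n k
∈-listsUpTo {k = zero}  {[]}     _         = here refl
∈-listsUpTo {k = suc k} {[]}     _         = here refl
∈-listsUpTo {k = suc k} {x ∷ xs} (s≤s len) = there (∈-cartesianProductWith⁺ _∷_ (∈-allFin x) (∈-listsUpTo len))

unique-listsUpTo : ∀ n k → Unique (listsUpTo n k)
unique-listsUpTo n zero    = [] ∷ []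
unique-listsUpTo n (suc k) =
  ¬Any⇒All¬ _ []∉ ∷ Unique.cartesianProductWith⁺ _∷_ (λ { refl → refl , refl }) (Unique.allFin⁺ n) (unique-listsUpTo n k)
  where
  []∉ : [] ∉ cartesianProductWith _∷_ (allFin n) (listsUpTo n k)
  []∉ []∈ with ∈-cartesianProductWith⁻ _∷_ (allFin n) (listsUpTo n k) []∈
  ... | _ , _ , _ , _ , ()

-- Sums modulo 2

⨁ : List A → (A → Bool) → Bool
⨁ []       f = false
⨁ (x ∷ xs) f = f x xor ⨁ xs f

⨁-cong-∈ : ∀ (xs : List A) {f h : A → Bool} → (∀ {x} → x ∈ xs → f x ≡ h x) → ⨁ xs f ≡ ⨁ xs h
⨁-cong-∈ []       eq = refl
⨁-cong-∈ (x ∷ xs) eq = cong₂ _xor_ (eq (here refl)) (⨁-cong-∈ xs (eq ∘ there))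

⨁-cong : ∀ (xs : List A) {f h : A → Bool} → (∀ x → f x ≡ h x) → ⨁ xs f ≡ ⨁ xs h
⨁-cong xs eq = ⨁-cong-∈ xs λ _ → eq _

⨁-false : ∀ (xs : List A) → ⨁ xs (λ _ → false) ≡ false
⨁-false []       = refl
⨁-false (x ∷ xs) = ⨁-false xs

⨁-xor : ∀ (xs : List A) (f h : A → Bool) → ⨁ xs (λ x → f x xor h x) ≡ ⨁ xs f xor ⨁ xs h
⨁-xor []       f h = refl
⨁-xor (x ∷ xs) f h = trans (cong ((f x xor h x) xor_) (⨁-xor xs f h)) (interchange (f x) (h x) _ _)

⨁-∧ˡ : ∀ b (xs : List A) (f : A → Bool) → ⨁ xs (λ x → b ∧ f x) ≡ b ∧ ⨁ xs f
⨁-∧ˡ false xs f = ⨁-false xs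
⨁-∧ˡ true  xs f = refl

⨁-∉ : ∀ (_≟_ : DecidableEquality A) {y} (xs : List A) (f : A → Bool) → y ∉ xs →
      ⨁ xs (λ x → f x ∧ does (x ≟ y)) ≡ false
⨁-∉ _≟_ xs f y∉xs = trans
  (⨁-cong-∈ xs λ {x} x∈xs → trans (cong (f x ∧_) (dec-false (x ≟ _) λ { refl → y∉xs x∈xs })) (∧-zeroʳ (f x)))
  (⨁-false xs)

⨁-pick : ∀ (_≟_ : DecidableEquality A) {y} {xs : List A} (f : A → Bool) → Unique xs → y ∈ xs →
         ⨁ xs (λ x → f x ∧ does (x ≟ y)) ≡ f y
⨁-pick _≟_ {y} {x ∷ xs} f u (here refl) = trans
  (cong₂ _xor_ (trans (cong (f y ∧_) (dec-true (y ≟ y) refl)) (∧-identityʳ (f y)))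
               (⨁-∉ _≟_ xs f (Unique.Unique[x∷xs]⇒x∉xs u)))
  (xor-identityʳ (f y))
⨁-pick _≟_ {y} {x ∷ xs} f u@(_ ∷ uxs) (there y∈xs) = trans
  (cong (_xor ⨁ xs (λ x → f x ∧ does (x ≟ y)))
        (trans (cong (f x ∧_) (dec-false (x ≟ y) λ { refl → Unique.Unique[x∷xs]⇒x∉xs u y∈xs })) (∧-zeroʳ (f x))))
  (⨁-pick _≟_ f uxs y∈xs)

⨁-++ : ∀ (xs {ys} : List A) (f : A → Bool) → ⨁ (xs ++ ys) f ≡ ⨁ xs f xor ⨁ ys f
⨁-++ []       f = refl
⨁-++ (x ∷ xs) f = trans (cong (f x xor_) (⨁-++ xs f)) (sym (xor-assoc (f x) _ _))

⨁-map : ∀ (xs : List A) (k : A → B) (f : B → Bool) → ⨁ (List.map k xs) f ≡ ⨁ xs (f ∘ k)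
⨁-map []       k f = refl
⨁-map (x ∷ xs) k f = cong (f (k x) xor_) (⨁-map xs k f)

⨁-cartesianProduct : ∀ (xs : List A) (ys : List B) (f : A × B → Bool) →
                     ⨁ (cartesianProduct xs ys) f ≡ ⨁ xs (λ x → ⨁ ys (λ y → f (x , y)))
⨁-cartesianProduct []       ys f = refl
⨁-cartesianProduct (x ∷ xs) ys f = trans
  (⨁-++ (List.map (x ,_) ys) f)
  (cong₂ _xor_ (⨁-map ys (x ,_) f) (⨁-cartesianProduct xs ys f))

-- The entries at (x, y) and (y, x) cancel, as in the handshake lemma.
⨁-symmetric : ∀ (xs : List A) (M : A → A → Bool) → (∀ x y → M x y ≡ M y x) → (∀ x → M x x ≡ false) →
              ⨁ xs (λ x → ⨁ xs (M x)) ≡ false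
⨁-symmetric []       M M-sym M-diag = refl
⨁-symmetric (x ∷ xs) M M-sym M-diag = trans
  (cong₂ _xor_ (cong (_xor ⨁ xs (M x)) (M-diag x)) (⨁-xor xs (λ y → M y x) (λ y → ⨁ xs (M y))))
  (trans (cong₂ (λ p q → ⨁ xs (M x) xor (p xor q)) (⨁-cong xs (λ y → M-sym y x)) (⨁-symmetric xs M M-sym M-diag))
         (trans (cong (⨁ xs (M x) xor_) (xor-identityʳ _)) (xor-same (⨁ xs (M x)))))

bool-⇔ : ∀ {x y} → (x ≡ true → y ≡ true) → (y ≡ true → x ≡ true) → x ≡ y
bool-⇔ {false} {false} _ _ = refl
bool-⇔ {false} {true}  _ g = g refl
bool-⇔ {true}  {y}     f _ = sym (f refl)

∧-true : ∀ {x y} → x ∧ y ≡ true → x ≡ true × y ≡ true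
∧-true {true} {true} refl = refl , refl

-- `M` is the matrix of σ on the set φ. The row of x sums to φ x, `M` is symmetric because σ is an
-- involution, and its diagonal vanishes because σ has no fixed point there; so `⨁-symmetric`
-- applies.
⨁-involution : ∀ (_≟_ : DecidableEquality A) {xs : List A} → Unique xs → (φ : A → Bool) (σ : A → A) →
               (∀ x → φ x ≡ true → σ x ∈ xs) → (∀ x → φ x ≡ true → φ (σ x) ≡ true) →
               (∀ x → φ x ≡ true → σ (σ x) ≡ x) → (∀ x → φ x ≡ true → σ x ≢ x) →
               ⨁ xs φ ≡ false
⨁-involution {A = A} _≟_ {xs} u φ σ σ-∈ σ-φ σσ σ-≢ = trans
  (⨁-cong xs (λ x → sym (row x))) (⨁-symmetric xs M (λ x y → bool-⇔ (M-swap x y) (M-swap y x)) M-diag)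
  where
  M : A → A → Bool
  M x y = φ x ∧ does (y ≟ σ x)

  M-swap : ∀ x y → M x y ≡ true → M y x ≡ true
  M-swap x y Mxy with ∧-true {φ x} Mxy
  ... | φx , y≡σx with does-true⇒ (y ≟ σ x) y≡σx
  ... | refl = cong₂ _∧_ (σ-φ x φx) (dec-true (x ≟ σ (σ x)) (sym (σσ x φx)))

  M-diag : ∀ x → M x x ≡ false
  M-diag x with φ x in φx
  ... | false = refl
  ... | true  = dec-false (x ≟ σ x) (σ-≢ x φx ∘ sym)

  row : ∀ x → ⨁ xs (M x) ≡ φ x
  row x with φ x in φx
  ... | false = ⨁-false xs
  ... | true  = ⨁-pick _≟_ (λ _ → true) u (σ-∈ x φx)

-- Linked lists: splitting, reversal, last element

linked-++⁻ʳ : {R : Rel A ℓ} → ∀ xs {ys} → Linked R (xs ++ ys) → Linked R ys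
linked-++⁻ʳ []               l       = l
linked-++⁻ʳ (x ∷ []) {[]}    l       = []
linked-++⁻ʳ (x ∷ []) {_ ∷ _} (_ ∷ l) = l
linked-++⁻ʳ (x ∷ y ∷ xs)     (_ ∷ l) = linked-++⁻ʳ (y ∷ xs) l

-- Each link of the front part is turned round as it moves to the accumulator. In a rotation, the
-- second hypothesis carries the new link from the old head y.
linked-ʳ++ : {R : Rel A ℓ} → Symmetric R → ∀ y ys {zs t} →
             Linked R (y ∷ ys ++ zs) → Linked R (y ∷ t) → Linked R (ys ʳ++ (y ∷ t))
linked-ʳ++ R-sym y []       _        l = l
linked-ʳ++ R-sym y (x ∷ ys) (Ryx ∷ k) l = linked-ʳ++ R-sym x ys k (R-sym Ryx ∷ l)

last-++-∷ : ∀ (xs : List A) {z zs} → last (xs ++ z ∷ zs) ≡ last (z ∷ zs)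
last-++-∷ []           = refl
last-++-∷ (x ∷ [])     = refl
last-++-∷ (x ∷ y ∷ xs) = last-++-∷ (y ∷ xs)

∷-snoc : ∀ (x : A) xs → ∃₂ λ us s → x ∷ xs ≡ us ++ s ∷ []
∷-snoc x []       = [] , x , refl
∷-snoc x (y ∷ xs) with ∷-snoc y xs
... | us , s , eq = x ∷ us , s , cong (x ∷_) eq

last-just-∈ : ∀ {v} (xs : List A) → last xs ≡ just v → v ∈ xs
last-just-∈ (x ∷ [])     refl = here refl
last-just-∈ (x ∷ y ∷ xs) eq   = there (last-just-∈ (y ∷ xs) eq)

-- Lollipop paths

-- Thomason's lollipop argument, with the vertices outside `required` optional.  A node is a path whose
-- last vertex v is fixed and whose head is free; prolonging it from v to w and from its head back to w
-- would close a cycle through the fixed edge v w.  A dart is a node with one edge at its head along which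
-- it can be rotated, extended, or (if the head is optional) retracted; each such move can be undone, so
-- darts come in pairs.
module Lollipop
  {n : ℕ} (g : Fin n → Fin n → Bool)
  (g-sym : ∀ a b → g a b ≡ g b a)
  (g-irrefl : ∀ a → g a a ≡ false)
  (w v : Fin n) (required : List (Fin n))
  {c₁ c₂ : Fin n} (c₁∈ : c₁ ∈ required) (c₂∈ : c₂ ∈ required) (c₁≢c₂ : c₁ ≢ c₂)
  where

  open DecMembership (_≟_ {n}) using (_∈?_)
  open DecUnique (_≟_ {n}) using (unique?)

  Adj : Fin n → Fin n → Set
  Adj a b = g a b ≡ true

  adj-sym : Symmetric Adj
  adj-sym {a} {b} e = trans (g-sym b a) e

  record Node (p : List (Fin n)) : Set where
    constructor node
    field
      uniq   : Unique p
      linked : Linked Adj p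
      end    : last p ≡ just v
      avoids : w ∉ p
      covers : All (_∈ p) required

  open Node

  node? : ∀ p → Dec (Node p)
  node? p = map′ (λ (a , b , c , d , e) → node a b c d e) (λ (node a b c d e) → a , b , c , d , e)
    (unique? p ×-dec linked? (λ a b → g a b Bool.≟ true) p ×-dec Maybe.≡-dec _≟_ (last p) (just v)
     ×-dec ¬? (w ∈? p) ×-dec All.all? (_∈? p) required)

  -- Two distinct required vertices force a second vertex on the path, which the definition of `h`
  -- refers to.
  node-shape : ∀ {p} → Node p → ∃₂ λ y x → ∃ λ q → p ≡ y ∷ x ∷ q
  node-shape {[]} N = case All.lookup (covers N) c₁∈ of λ ()
  node-shape {x ∷ []} N with All.lookup (covers N) c₁∈ | All.lookup (covers N) c₂∈
  ... | here refl | here refl = contradiction refl c₁≢c₂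
  node-shape {y ∷ x ∷ q} N = y , x , q , refl

  -- A required head may not be dropped: this excludes the edge back to the second vertex x.
  h : List (Fin n) → Fin n → Bool
  h (y ∷ x ∷ q) z = (g y z ∧ not (does (z ≟ w))) xor (does (y ∈? required) ∧ does (z ≟ x))
  h _           z = false

  closes : List (Fin n) → Bool
  closes (y ∷ _) = g y w
  closes []      = false

  φ : List (Fin n) × Fin n → Bool
  φ (p , z) = does (node? p) ∧ h p z

  split : Fin n → List (Fin n) → List (Fin n) × Maybe (List (Fin n))
  split z []      = [] , nothing
  split z (x ∷ p) with x ≟ z
  ... | yes _ = [] , just p
  ... | no  _ = map₁ (x ∷_) (split z p)

  split-∉ : ∀ {z} p → z ∉ p → split z p ≡ (p , nothing)
  split-∉     []      z∉ = refl
  split-∉ {z} (x ∷ p) z∉ with x ≟ z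
  ... | yes refl = contradiction (here refl) z∉
  ... | no  _    = cong (map₁ (x ∷_)) (split-∉ p (z∉ ∘ there))

  split-++ : ∀ {z} ys {zs} → z ∉ ys → split z (ys ++ z ∷ zs) ≡ (ys , just zs)
  split-++ {z} [] z∉ with z ≟ z
  ... | yes _   = refl
  ... | no  z≢z = contradiction refl z≢z
  split-++ {z} (x ∷ ys) z∉ with x ≟ z
  ... | yes refl = contradiction (here refl) z∉
  ... | no  _    = cong (map₁ (x ∷_)) (split-++ ys (z∉ ∘ there))

  -- The second component is the edge end by which the move is undone: the old head after an
  -- extension or a retraction, and z again after a rotation, whose new head was the predecessor of
  -- z. The clause for the empty path is a filler, as is a split with nothing before z.
  turn : List (Fin n) → Fin n → List (Fin n) × Maybe (List (Fin n)) → List (Fin n) × Fin n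
  turn (y ∷ p) z (_ , nothing)           = z ∷ y ∷ p , y
  turn []      z (_ , nothing)           = [] , z
  turn p       z (y ∷ [] , just zs)      = z ∷ zs , y
  turn p       z (ys , just zs)          = reverse ys ++ z ∷ zs , z

  σ : List (Fin n) × Fin n → List (Fin n) × Fin n
  σ (p , z) = turn p z (split z p)

  σ-extend : ∀ {y p x} → x ∉ y ∷ p → σ (y ∷ p , x) ≡ (x ∷ y ∷ p , y)
  σ-extend {y} {p} {x} x∉ = cong (turn (y ∷ p) x) (split-∉ (y ∷ p) x∉)

  σ-retract : ∀ {y x p} → x ≢ y → σ (y ∷ x ∷ p , x) ≡ (x ∷ p , y)
  σ-retract {y} {x} {p} x≢y = cong (turn (y ∷ x ∷ p) x) (split-++ (y ∷ []) λ { (here eq) → x≢y eq })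

  segment : Fin n → List (Fin n) → Fin n → List (Fin n)
  segment y us s = y ∷ us ++ s ∷ []

  segment-++ : ∀ y us s zs → segment y us s ++ zs ≡ y ∷ us ++ s ∷ zs
  segment-++ y us s zs = cong (y ∷_) (++-assoc us (s ∷ []) zs)

  reverse-segment : ∀ y us s → reverse (segment y us s) ≡ segment s (reverse us) y
  reverse-segment y us s = trans (unfold-reverse y (us ++ s ∷ [])) (cong (_++ y ∷ []) (reverse-++ us (s ∷ [])))

  σ-rotate : ∀ {y us s z zs} → z ∉ segment y us s →
             σ (segment y us s ++ z ∷ zs , z) ≡ (segment s (reverse us) y ++ z ∷ zs , z)
  σ-rotate {y} {us} {s} {z} {zs} z∉ = trans
    (cong (turn (segment y us s ++ z ∷ zs) z) (split-++ (segment y us s) z∉))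
    (trans (turn-segment us) (cong (λ r → r ++ z ∷ zs , z) (reverse-segment y us s)))
    where
    turn-segment : ∀ us {p} → turn p z (segment y us s , just zs) ≡ (reverse (segment y us s) ++ z ∷ zs , z)
    turn-segment []      {[]}    = refl
    turn-segment []      {_ ∷ _} = refl
    turn-segment (_ ∷ _) {[]}    = refl
    turn-segment (_ ∷ _) {_ ∷ _} = refl

  -- The set `φ`, sorted by where the far end of the dart's edge lies: off the path, second on it,
  -- or third and later. The indices display the path in the shape on which `σ` computes.
  data Dart : List (Fin n) × Fin n → Set where
    extend  : ∀ {y p x} → Node (y ∷ p) → x ∉ y ∷ p → x ≢ w → Adj y x → Dart (y ∷ p , x)
    retract : ∀ {y x p} → Node (y ∷ x ∷ p) → y ∉ required → Dart (y ∷ x ∷ p , x)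
    rotate  : ∀ {y us s z zs} → Node (segment y us s ++ z ∷ zs) → Adj y z → Dart (segment y us s ++ z ∷ zs , z)

  unique-++⇒∉ˡ : ∀ xs {z : Fin n} {zs} → Unique (xs ++ z ∷ zs) → z ∉ xs
  unique-++⇒∉ˡ (x ∷ xs) u       (here refl) = Unique.Unique[x∷xs]⇒x∉xs u (∈-++⁺ʳ xs (here refl))
  unique-++⇒∉ˡ (x ∷ xs) (_ ∷ u) (there z∈)  = unique-++⇒∉ˡ xs u z∈

  second≢ : ∀ {y x q} → Node (y ∷ x ∷ q) → y ≢ x
  second≢ N refl = Unique.Unique[x∷xs]⇒x∉xs (uniq N) (here refl)

  h-true : ∀ {y x} q {z} → Adj y z → z ≢ w → (y ∈ required → z ≢ x) → h (y ∷ x ∷ q) z ≡ true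
  h-true {y} {x} q {z} gyz z≢w z≢x rewrite gyz | dec-false (z ≟ w) z≢w with y ∈? required
  ... | no  _  = refl
  ... | yes y∈ rewrite dec-false (z ≟ x) (z≢x y∈) = refl

  h-true⁻¹ : ∀ {y x} q {z} → z ≢ x → h (y ∷ x ∷ q) z ≡ true → Adj y z × z ≢ w
  h-true⁻¹ {y} {x} q {z} z≢x hz rewrite dec-false (z ≟ x) z≢x | ∧-zeroʳ (does (y ∈? required))
                                      | xor-identityʳ (g y z ∧ not (does (z ≟ w))) with g y z | z ≟ w
  ... | true  | no z≢w = refl , z≢w

  Dart⇒φ : ∀ {d} → Dart d → φ d ≡ true
  Dart⇒φ (extend {y} {p} N x∉ x≢w gyx) with node-shape N
  ... | _ , _ , q , refl = cong₂ _∧_ (dec-true (node? _) N) (h-true q gyx x≢w λ { _ refl → x∉ (there (here refl)) })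
  Dart⇒φ (retract {p = p} N y∉) = cong₂ _∧_ (dec-true (node? _) N)
    (h-true p (case linked N of λ { (e ∷ _) → e }) (λ { refl → avoids N (there (here refl)) }) (λ y∈ _ → y∉ y∈))
  Dart⇒φ (rotate {us = []} {z = z} {zs} N gyz) = cong₂ _∧_ (dec-true (node? _) N)
    (h-true (z ∷ zs) gyz (λ { refl → avoids N (there (there (here refl))) })
                  λ { _ refl → case uniq N of λ { (_ ∷ u) → Unique.Unique[x∷xs]⇒x∉xs u (here refl) } })
  Dart⇒φ (rotate {y} {x ∷ us} {s} {z} {zs} N gyz) = cong₂ _∧_ (dec-true (node? _) N)
    (h-true ((us ++ s ∷ []) ++ z ∷ zs) gyz (λ { refl → avoids N (∈-++⁺ʳ (segment y (x ∷ us) s) (here refl)) })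
                  λ { _ refl → unique-++⇒∉ˡ (segment y (x ∷ us) s) (uniq N) (there (here refl)) })

  φ⇒Dart : ∀ d → φ d ≡ true → Dart d
  φ⇒Dart (p , z) φd with ∧-true {does (node? p)} φd
  ... | np , hz with does-true⇒ (node? p) np
  ... | N with node-shape N
  ... | y , x , q , refl with z ∈? (y ∷ x ∷ q)
  ... | no z∉ = let gyz , z≢w = h-true⁻¹ q (λ { refl → z∉ (there (here refl)) }) hz in extend N z∉ z≢w gyz
  ... | yes (here refl) = contradiction
    (trans (sym (proj₁ (h-true⁻¹ q (second≢ N) hz))) (g-irrefl y)) λ ()
  ... | yes (there (there z∈q)) = far (∈-∃++ z∈q) N
          (h-true⁻¹ q (λ { refl → case uniq N of λ { (_ ∷ u) → Unique.Unique[x∷xs]⇒x∉xs u z∈q } }) hz)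
    where
    far : (∃₂ λ as bs → q ≡ as ++ z ∷ bs) → Node (y ∷ x ∷ q) → Adj y z × z ≢ w → Dart (y ∷ x ∷ q , z)
    far (as , bs , refl) N (gyz , _) with ∷-snoc x as
    ... | us , s , eq = subst (λ p → Dart (p , z)) p≡ (rotate (subst Node (sym p≡) N) gyz)
      where
      p≡ : segment y us s ++ z ∷ bs ≡ y ∷ x ∷ as ++ z ∷ bs
      p≡ = cong (λ t → y ∷ t ++ z ∷ bs) (sym eq)
  ... | yes (there (here refl)) with y ∈? required
  ... | no  y∉ = retract N y∉
  ... | yes _  = contradiction hz (contra (case linked N of λ { (e ∷ _) → e }) λ { refl → avoids N (there (here refl)) })
    where
    contra : Adj y x → x ≢ w → (g y x ∧ not (does (x ≟ w))) xor (does (x ≟ x)) ≢ true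
    contra gyx x≢w rewrite gyx | dec-false (x ≟ w) x≢w | dec-true (x ≟ x) refl = λ ()

  record Partner (d : List (Fin n) × Fin n) : Set where
    field
      d′    : List (Fin n) × Fin n
      σd    : σ d ≡ d′
      dart′ : Dart d′
      σd′   : σ d′ ≡ d
      d′≢d  : d′ ≢ d

  partner : ∀ {d} → Dart d → Partner d
  partner (extend {y} {p} {x} N x∉ x≢w gyx) = record
    { σd = σ-extend x∉ ; σd′ = σ-retract (λ { refl → x∉ (here refl) })
    ; d′≢d = λ ()
    ; dart′ = retract
        (node (¬Any⇒All¬ _ x∉ ∷ uniq N) (adj-sym gyx ∷ linked N) (end N)
              (λ { (here refl) → x≢w refl ; (there w∈) → avoids N w∈ }) (All.map there (covers N)))
        λ x∈ → x∉ (All.lookup (covers N) x∈) }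
  partner (retract {y} {x} {p} N@(node u@(_ ∷ ux) (e ∷ l) en av cov) y∉) = record
    { σd = σ-retract (second≢ N ∘ sym) ; σd′ = σ-extend (Unique.Unique[x∷xs]⇒x∉xs u)
    ; d′≢d = λ ()
    ; dart′ = extend
        (node ux l en (av ∘ there)
              (All.tabulate λ c∈ → case All.lookup cov c∈ of λ { (here refl) → contradiction c∈ y∉ ; (there c∈′) → c∈′ }))
        (Unique.Unique[x∷xs]⇒x∉xs u) (λ { refl → av (here refl) }) (adj-sym e) }
  partner (rotate {y} {us} {s} {z} {zs} N gyz) = record
    { σd = σ-rotate {us = us} z∉ ; σd′ = trans (σ-rotate {us = reverse us} z∉′)
        (cong (λ us → segment y us s ++ z ∷ zs , z) (reverse-involutive us))
    ; d′≢d = s≢y ∘ cong (λ { (x ∷ _ , _) → x ; ([] , _) → y })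
    ; dart′ = rotate (node
        (Unique-resp-↭ (setoid (Fin n)) (↭⇒↭ₛ (↭-sym perm)) (uniq N))
        linked′
        (trans (last-++-∷ (segment s (reverse us) y)) (trans (sym (last-++-∷ (segment y us s))) (end N)))
        (avoids N ∘ ∈-resp-↭ perm)
        (All.map (∈-resp-↭ (↭-sym perm)) (covers N)))
        gsz }
    where
    perm : segment s (reverse us) y ++ z ∷ zs ↭ segment y us s ++ z ∷ zs
    perm = ++⁺ʳ (z ∷ zs) (subst (_↭ segment y us s) (reverse-segment y us s) (↭-reverse (segment y us s)))

    z∉ : z ∉ segment y us s
    z∉ = unique-++⇒∉ˡ (segment y us s) (uniq N)

    z∉′ : z ∉ segment s (reverse us) y
    z∉′ = unique-++⇒∉ˡ (segment s (reverse us) y) (Unique-resp-↭ (setoid (Fin n)) (↭⇒↭ₛ (↭-sym perm)) (uniq N))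

    s≢y : s ≢ y
    s≢y refl = Unique.Unique[x∷xs]⇒x∉xs (uniq N) (∈-++⁺ˡ (∈-++⁺ʳ us (here refl)))

    tail-linked : Linked Adj (s ∷ z ∷ zs)
    tail-linked = linked-++⁻ʳ (y ∷ us) (subst (Linked Adj) (segment-++ y us s (z ∷ zs)) (linked N))

    gsz : Adj s z
    gsz = case tail-linked of λ { (e ∷ _) → e }

    linked′ : Linked Adj (segment s (reverse us) y ++ z ∷ zs)
    linked′ = subst (Linked Adj)
      (trans (ʳ++-defn (segment y us s)) (cong (_++ z ∷ zs) (reverse-segment y us s)))
      (linked-ʳ++ adj-sym y (us ++ s ∷ []) (linked N) (gyz ∷ (case tail-linked of λ { (_ ∷ l) → l })))

  paths : List (List (Fin n))
  paths = listsUpTo n n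

  Dart⇒Node : ∀ {p z} → Dart (p , z) → Node p
  Dart⇒Node (extend N _ _ _) = N
  Dart⇒Node (retract N _)    = N
  Dart⇒Node (rotate N _)     = N

  darts-even : ⨁ (cartesianProduct paths (allFin n)) φ ≡ false
  darts-even = ⨁-involution (Product.≡-dec (List.≡-dec _≟_) _≟_)
    (Unique.cartesianProduct⁺ (unique-listsUpTo n n) (Unique.allFin⁺ n)) φ σ
    (λ d φd → ∈-dart (subst Dart (sym (σd (P d φd))) (dart′ (P d φd))))
    (λ d φd → Dart⇒φ (subst Dart (sym (σd (P d φd))) (dart′ (P d φd))))
    (λ d φd → trans (cong σ (σd (P d φd))) (σd′ (P d φd)))
    (λ d φd → d′≢d (P d φd) ∘ trans (sym (σd (P d φd))))
    where
    open Partner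
    P : ∀ d → φ d ≡ true → Partner d
    P d φd = partner (φ⇒Dart d φd)

    ∈-dart : ∀ {d} → Dart d → d ∈ cartesianProduct paths (allFin n)
    ∈-dart {p , z} D = ∈-cartesianProduct⁺ (∈-listsUpTo (unique⇒length≤n (uniq (Dart⇒Node D)))) (∈-allFin z)

  module _ (degree : ∀ a → a ≢ w → ⨁ (allFin n) (g a) ≡ does (a ∈? required)) where

    ∧-not : ∀ x y → x ∧ not y ≡ x xor (x ∧ y)
    ∧-not false y     = refl
    ∧-not true  false = refl
    ∧-not true  true  = refl

    -- At a node, the degree of the head is odd exactly if the head is required, and exactly then
    -- the edge to its successor is excluded. These two contributions cancel, leaving the excluded
    -- edge to w.
    row : ∀ p → ⨁ (allFin n) (λ z → φ (p , z)) ≡ does (node? p) ∧ closes p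
    row p = trans (⨁-∧ˡ (does (node? p)) (allFin n) (h p)) (row′ (node? p))
      where
      row′ : (N? : Dec (Node p)) → does N? ∧ ⨁ (allFin n) (h p) ≡ does N? ∧ closes p
      row′ (no _)  = refl
      row′ (yes N) with node-shape N
      ... | y , x , q , refl = begin
        ⨁ V (h p)                                                   ≡⟨ ⨁-xor V _ _ ⟩
        ⨁ V (λ z → g y z ∧ not (does (z ≟ w))) xor
          ⨁ V (λ z → does (y ∈? required) ∧ does (z ≟ x))           ≡⟨ cong₂ _xor_ neighbours
                                                                        (⨁-pick _≟_ (λ _ → does (y ∈? required)) (Unique.allFin⁺ n) (∈-allFin x)) ⟩
        (does (y ∈? required) xor g y w) xor does (y ∈? required)    ≡⟨ cong (_xor does (y ∈? required)) (xor-comm _ (g y w)) ⟩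
        (g y w xor does (y ∈? required)) xor does (y ∈? required)    ≡⟨ xor-assoc (g y w) _ _ ⟩
        g y w xor (does (y ∈? required) xor does (y ∈? required))    ≡⟨ cong (g y w xor_) (xor-same (does (y ∈? required))) ⟩
        g y w xor false                                              ≡⟨ xor-identityʳ _ ⟩
        g y w ∎
        where
        open ≡-Reasoning
        V : List (Fin n)
        V = allFin n
        neighbours : ⨁ V (λ z → g y z ∧ not (does (z ≟ w))) ≡ does (y ∈? required) xor g y w
        neighbours = trans (⨁-cong V λ z → ∧-not (g y z) _) (trans (⨁-xor V (g y) _)
          (cong₂ _xor_ (degree y λ { refl → avoids N (here refl) }) (⨁-pick _≟_ (g y) (Unique.allFin⁺ n) (∈-allFin w))))

    -- Double counting: the darts, evenly many in all, are summed node by node, and a node has an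
    -- odd number of them exactly if it closes.
    closing-even : ⨁ paths (λ p → does (node? p) ∧ closes p) ≡ false
    closing-even = trans (sym (trans (⨁-cartesianProduct paths (allFin n) φ) (⨁-cong paths row))) darts-even

-- Arcs inside a longest cycle

linked-++⁻ˡ : {R : Rel A ℓ} → ∀ xs {ys} → Linked R (xs ++ ys) → Linked R xs
linked-++⁻ˡ []           l       = []
linked-++⁻ˡ (x ∷ [])     l       = [-]
linked-++⁻ˡ (x ∷ y ∷ xs) (r ∷ l) = r ∷ linked-++⁻ˡ (y ∷ xs) l

linked-map-∈ : {R : Rel A ℓ} {S : Rel A ℓ′} → ∀ {xs} →
               (∀ {x y} → x ∈ xs → y ∈ xs → R x y → S x y) → Linked R xs → Linked S xs
linked-map-∈ f []      = []
linked-map-∈ f [-]     = [-]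
linked-map-∈ f (r ∷ l) = f (here refl) (there (here refl)) r ∷ linked-map-∈ (λ x∈ y∈ → f (there x∈) (there y∈)) l

closed⇒linked : {R : Rel A ℓ} → ∀ x xs {z} → All (uncurry R) (zip (x ∷ xs) (xs ∷ʳ z)) → Linked R (x ∷ xs ∷ʳ z)
closed⇒linked x []       (r ∷ []) = r ∷ [-]
closed⇒linked x (y ∷ xs) (r ∷ rs) = r ∷ closed⇒linked y xs rs

linked⇒closed : {R : Rel A ℓ} → ∀ x xs {z} → Linked R (x ∷ xs ∷ʳ z) → All (uncurry R) (zip (x ∷ xs) (xs ∷ʳ z))
linked⇒closed x []       (r ∷ _)  = r ∷ []
linked⇒closed x (y ∷ xs) (r ∷ rs) = r ∷ linked⇒closed y xs rs

length≤1⇒≡ : ∀ {xs : List A} {x y} → length xs ≤ 1 → x ∈ xs → y ∈ xs → x ≡ y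
length≤1⇒≡ {xs = _ ∷ []}    _        (here refl) (here refl) = refl
length≤1⇒≡ {xs = _ ∷ _ ∷ _} (s≤s ()) _           _

data Consecutive {A : Set a} : List A → A → A → Set a where
  here  : ∀ {x y xs} → Consecutive (x ∷ y ∷ xs) x y
  there : ∀ {x xs y z} → Consecutive xs y z → Consecutive (x ∷ xs) y z

linked⇒consecutive : {R : Rel A ℓ} → ∀ {xs x y} → Linked R xs → Consecutive xs x y → R x y
linked⇒consecutive (r ∷ _)  here      = r
linked⇒consecutive (_ ∷ rs) (there c) = linked⇒consecutive rs c
linked⇒consecutive [-]      (there ())

consecutive-linked : ∀ (xs : List A) → Linked (Consecutive xs) xs
consecutive-linked []           = []
consecutive-linked (x ∷ [])     = [-]
consecutive-linked (x ∷ y ∷ xs) = here ∷ Linked.map there (consecutive-linked (y ∷ xs))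

consecutive⇒∈ : ∀ {xs : List A} {x y} → Consecutive xs x y → x ∈ xs × y ∈ xs
consecutive⇒∈ here      = here refl , there (here refl)
consecutive⇒∈ (there c) = let x∈ , y∈ = consecutive⇒∈ c in there x∈ , there y∈

Neighbours : List A → Rel A _
Neighbours xs x y = Consecutive xs x y ⊎ Consecutive xs y x

neighbours⇒∈ : ∀ {xs : List A} {x y} → Neighbours xs x y → x ∈ xs × y ∈ xs
neighbours⇒∈ (inj₁ c) = consecutive⇒∈ c
neighbours⇒∈ (inj₂ c) = let y∈ , x∈ = consecutive⇒∈ c in x∈ , y∈

neighbours-tail : ∀ {xs : List A} {z x y} → x ≢ z → y ≢ z → Neighbours (z ∷ xs) x y → Neighbours xs x y
neighbours-tail x≢z y≢z (inj₁ here)      = contradiction refl x≢z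
neighbours-tail x≢z y≢z (inj₁ (there c)) = inj₁ c
neighbours-tail x≢z y≢z (inj₂ here)      = contradiction refl y≢z
neighbours-tail x≢z y≢z (inj₂ (there c)) = inj₂ c

-- An end of a path has a single neighbour on it. Moving there and deleting the end leaves a shorter
-- path with the same property, so a walk without repetition has no choice.
linked-neighbours⇒≡ : ∀ {x : A} {l p} → Unique (x ∷ l) → Unique (x ∷ p) → Linked (Neighbours (x ∷ l)) (x ∷ p) →
                      length p ≡ length l → p ≡ l
linked-neighbours⇒≡ {l = []}    {[]}    ul up k len = refl
linked-neighbours⇒≡ {x = x} {l = z ∷ l} {y ∷ p} ul@(_ ∷ ul′) up@(_ ∷ up′) (r ∷ k) len = step (first r)
  where
  first : Neighbours (x ∷ z ∷ l) x y → y ≡ z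
  first (inj₁ here)      = refl
  first (inj₁ (there c)) = contradiction (proj₁ (consecutive⇒∈ c)) (Unique.Unique[x∷xs]⇒x∉xs ul)
  first (inj₂ here)      = contradiction (here refl) (Unique.Unique[x∷xs]⇒x∉xs up)
  first (inj₂ (there c)) = contradiction (proj₂ (consecutive⇒∈ c)) (Unique.Unique[x∷xs]⇒x∉xs ul)

  step : y ≡ z → y ∷ p ≡ z ∷ l
  step refl = cong (y ∷_) (linked-neighbours⇒≡ ul′ up′
    (linked-map-∈ (λ a∈ b∈ → neighbours-tail (λ { refl → Unique.Unique[x∷xs]⇒x∉xs up a∈ })
                                             (λ { refl → Unique.Unique[x∷xs]⇒x∉xs up b∈ })) k)
    (suc-injective len))

-- Edge sets modulo 2, joins, and the rerouting of a longest cycle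

module _ {n : ℕ} where

  open DecMembership (_≟_ {n}) using (_∈?_)

  private
    V : List (Fin n)
    V = allFin n

  χ : Fin n → Fin n → Bool
  χ x a = does (a ≟ x)

  χ-sym : ∀ a x → χ x a ≡ χ a x
  χ-sym a x = bool-⇔ (λ e → dec-true (x ≟ a) (sym (does-true⇒ (a ≟ x) e)))
                     (λ e → dec-true (a ≟ x) (sym (does-true⇒ (x ≟ a) e)))

  ⨁-χ : ∀ {us} a → Unique us → ⨁ us (λ u → χ u a) ≡ does (a ∈? us)
  ⨁-χ {us} a u = trans (⨁-cong us (χ-sym a)) (cases (a ∈? us))
    where
    cases : (d : Dec (a ∈ us)) → ⨁ us (χ a) ≡ does d
    cases (yes a∈) = ⨁-pick _≟_ (λ _ → true) u a∈
    cases (no a∉)  = ⨁-∉ _≟_ us (λ _ → true) a∉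

  -- The xor keeps the indicator symmetric and makes it vanish for x = y, so that walks may contain
  -- loops.
  edge : Fin n → Fin n → Fin n → Fin n → Bool
  edge x y a b = (χ x a ∧ χ y b) xor (χ y a ∧ χ x b)

  edge-sym : ∀ x y a b → edge x y a b ≡ edge x y b a
  edge-sym x y a b = trans (xor-comm (χ x a ∧ χ y b) _) (cong₂ _xor_ (∧-comm (χ y a) _) (∧-comm (χ x a) _))

  edge-diag : ∀ x y a → edge x y a a ≡ false
  edge-diag x y a = trans (cong (_xor (χ y a ∧ χ x a)) (∧-comm (χ x a) _)) (xor-same (χ y a ∧ χ x a))

  edge-degree : ∀ x y a → ⨁ V (edge x y a) ≡ χ x a xor χ y a
  edge-degree x y a = trans (⨁-xor V _ _) (cong₂ _xor_
    (⨁-pick _≟_ (λ _ → χ x a) (Unique.allFin⁺ n) (∈-allFin y)) (⨁-pick _≟_ (λ _ → χ y a) (Unique.allFin⁺ n) (∈-allFin x)))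

  xor-telescope : ∀ x y z → (x xor y) xor (y xor z) ≡ x xor z
  xor-telescope x y z = trans (xor-assoc x y _) (cong (x xor_)
    (trans (sym (xor-assoc y y z)) (cong (_xor z) (xor-same y))))

  xor-true : ∀ {x y} → x xor y ≡ true → x ≡ true ⊎ y ≡ true
  xor-true {true}  _ = inj₁ refl
  xor-true {false} e = inj₂ e

  edge-true⁻¹ : ∀ x y a b → edge x y a b ≡ true → (a ≡ x × b ≡ y) ⊎ (a ≡ y × b ≡ x)
  edge-true⁻¹ x y a b e with xor-true {χ x a ∧ χ y b} e
  ... | inj₁ e₁ = let p , q = ∧-true e₁ in inj₁ (does-true⇒ (a ≟ x) p , does-true⇒ (b ≟ y) q)
  ... | inj₂ e₂ = let p , q = ∧-true e₂ in inj₂ (does-true⇒ (a ≟ y) p , does-true⇒ (b ≟ x) q)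

  edge-self : ∀ {x y} → x ≢ y → edge x y x y ≡ true
  edge-self {x} {y} x≢y rewrite dec-true (x ≟ x) refl | dec-true (y ≟ y) refl | dec-false (x ≟ y) x≢y = refl

  edge-false : ∀ {x y a b} → ¬ (a ≡ x × b ≡ y) → ¬ (a ≡ y × b ≡ x) → edge x y a b ≡ false
  edge-false {x} {y} {a} {b} p q = ¬-not ([ p , q ]′ ∘ edge-true⁻¹ x y a b)

  -- A T-join: f is the indicator of a set of edges of R, and odd marks the vertices T.
  record Join (R : Rel (Fin n) 0ℓ) (odd : Fin n → Bool) : Set where
    field
      f       : Fin n → Fin n → Bool
      f-sym   : ∀ a b → f a b ≡ f b a
      f-diag  : ∀ a → f a a ≡ false
      support : ∀ {a b} → f a b ≡ true → R a b
      degree  : ∀ a → ⨁ V (f a) ≡ odd a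

  module _ {R : Rel (Fin n) 0ℓ} where

    join-∅ : Join R (λ _ → false)
    join-∅ = record { f = λ _ _ → false ; f-sym = λ _ _ → refl ; f-diag = λ _ → refl
                    ; support = λ () ; degree = λ _ → ⨁-false V }

    join-xor : ∀ {odd odd′} → Join R odd → Join R odd′ → Join R (λ a → odd a xor odd′ a)
    join-xor J K = record
      { f = λ a b → J.f a b xor K.f a b
      ; f-sym = λ a b → cong₂ _xor_ (J.f-sym a b) (K.f-sym a b)
      ; f-diag = λ a → cong₂ _xor_ (J.f-diag a) (K.f-diag a)
      ; support = [ J.support , K.support ]′ ∘ xor-true
      ; degree = λ a → trans (⨁-xor V (J.f a) (K.f a)) (cong₂ _xor_ (J.degree a) (K.degree a)) }
      where
      module J = Join J
      module K = Join K

    join-cong : ∀ {odd odd′} → (∀ a → odd a ≡ odd′ a) → Join R odd → Join R odd′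
    join-cong eq J = record { Join J ; degree = λ a → trans (Join.degree J a) (eq a) }

    module _ (R-sym : Symmetric R) where

      join-edge : ∀ {x y} → R x y → Join R (λ a → χ x a xor χ y a)
      join-edge {x} {y} Rxy = record
        { f = edge x y ; f-sym = edge-sym x y ; f-diag = edge-diag x y
        ; support = λ {a} {b} e → case edge-true⁻¹ x y a b e of λ { (inj₁ (refl , refl)) → Rxy ; (inj₂ (refl , refl)) → R-sym Rxy }
        ; degree = edge-degree x y }

      -- Edges are counted modulo 2, so a walk may repeat them; the parities of its inner vertices
      -- telescope away.
      join-walk : ∀ {x y} → Star R x y → Join R (λ a → χ x a xor χ y a)
      join-walk {x} ε = join-cong (λ a → sym (xor-same (χ x a))) join-∅
      join-walk {x} {y} (_◅_ {j = z} r rs) = 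
        join-cong (λ a → xor-telescope (χ x a) (χ z a) (χ y a)) (join-xor (join-edge r) (join-walk rs))

      -- Each member of `us` becomes odd, while all the surplus parity is collected at w. This is
      -- why the lollipop argument asks nothing of the degree of w.
      join-walks : ∀ us {w} → (∀ u → Star R u w) → Join R (λ a → ⨁ us (λ u → χ u a xor χ w a))
      join-walks []       walk = join-∅
      join-walks (u ∷ us) walk = join-xor (join-walk (walk u)) (join-walks us walk)

  trail : List (Fin n) → Fin n → Fin n → Bool
  trail []           a b = false
  trail (x ∷ [])     a b = false
  trail (x ∷ y ∷ xs) a b = edge x y a b xor trail (y ∷ xs) a b

  trail-sym : ∀ xs a b → trail xs a b ≡ trail xs b a
  trail-sym []           a b = refl
  trail-sym (x ∷ [])     a b = refl
  trail-sym (x ∷ y ∷ xs) a b = cong₂ _xor_ (edge-sym x y a b) (trail-sym (y ∷ xs) a b)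

  trail-diag : ∀ xs a → trail xs a a ≡ false
  trail-diag []           a = refl
  trail-diag (x ∷ [])     a = refl
  trail-diag (x ∷ y ∷ xs) a = cong₂ _xor_ (edge-diag x y a) (trail-diag (y ∷ xs) a)

  trail-true⁻¹ : ∀ xs {a b} → trail xs a b ≡ true → Neighbours xs a b
  trail-true⁻¹ (x ∷ y ∷ xs) {a} {b} t = [ first , Sum.map there there ∘ trail-true⁻¹ (y ∷ xs) ]′ (xor-true {edge x y a b} t)
    where
    first : edge x y a b ≡ true → Neighbours (x ∷ y ∷ xs) a b
    first e = case edge-true⁻¹ x y a b e of λ { (inj₁ (refl , refl)) → inj₁ here ; (inj₂ (refl , refl)) → inj₂ here }

  trail-∉ : ∀ xs {a b} → b ∉ xs → trail xs a b ≡ false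
  trail-∉ xs b∉ = ¬-not (b∉ ∘ proj₂ ∘ neighbours⇒∈ ∘ trail-true⁻¹ xs)

  -- A path without repeated vertices traverses no edge twice, so nothing cancels in the xor.
  trail-consecutive : ∀ {xs a b} → Unique xs → Consecutive xs a b → trail xs a b ≡ true
  trail-consecutive {x ∷ y ∷ xs} u here
    rewrite edge-self {x} {y} (λ { refl → Unique.Unique[x∷xs]⇒x∉xs u (here refl) })
          | trail-sym (y ∷ xs) x y | trail-∉ (y ∷ xs) {y} (Unique.Unique[x∷xs]⇒x∉xs u) = refl
  trail-consecutive {x ∷ y ∷ xs} {a} {b} u@(_ ∷ uxs) (there c)
    rewrite edge-false {x} {y} {a} {b} (λ { (refl , _) → Unique.Unique[x∷xs]⇒x∉xs u (proj₁ (consecutive⇒∈ c)) })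
                                       (λ { (_ , refl) → Unique.Unique[x∷xs]⇒x∉xs u (proj₂ (consecutive⇒∈ c)) }) =
    trail-consecutive uxs c

  trail-degree : ∀ x xs z a → ⨁ V (trail (x ∷ xs ∷ʳ z) a) ≡ χ x a xor χ z a
  trail-degree x []       z a = trans (⨁-cong V λ b → xor-identityʳ (edge x z a b)) (edge-degree x z a)
  trail-degree x (y ∷ xs) z a = trans (⨁-xor V _ _) (trans (cong₂ _xor_ (edge-degree x y a) (trail-degree y xs z a))
    (xor-telescope (χ x a) (χ y a) (χ z a)))

  -- If the edges T off C connected all vertices, they would contain a set f of edges with odd degree
  -- exactly at C (except possibly at w).  In g = C + f, every vertex of C other than w has odd degree and
  -- all others even degree, so C is not the only cycle of g through v w that covers C; a second one uses
  -- an edge of f, hence a vertex off C, and is longer than C.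
  module Reroute
    {D : Digraph n} (D-sym : Symmetric (Edge D))
    {w c v : Fin n} {m : List (Fin n)} (longest : IsLongestCycle D (w ∷ c ∷ m ∷ʳ v))
    {T : Rel (Fin n) 0ℓ} (T-sym : Symmetric T) (T⇒D : ∀ {a b} → T a b → Edge D a b)
    (T-outside : ∀ {a b} → T a b → a ∈ w ∷ c ∷ m ∷ʳ v → b ∉ w ∷ c ∷ m ∷ʳ v) (T-connected : ∀ u → Star T u w)
    where

    cs C : List (Fin n)
    cs = c ∷ m ∷ʳ v
    C  = w ∷ cs

    open IsCycle (proj₁ longest)

    w∉cs : w ∉ cs
    w∉cs = Unique.Unique[x∷xs]⇒x∉xs distinct

    unique-cs : Unique cs
    unique-cs = case distinct of λ { (_ ∷ u) → u }

    v∈cs : v ∈ cs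
    v∈cs = ∈-++⁺ʳ (c ∷ m) (here refl)

    c≢v : c ≢ v
    c≢v refl = Unique.Unique[x∷xs]⇒x∉xs unique-cs (∈-++⁺ʳ m (here refl))

    C-linked : Linked (Edge D) (w ∷ cs ∷ʳ w)
    C-linked = closed⇒linked w cs closed

    Dvw : Edge D v w
    Dvw = case linked-++⁻ʳ (w ∷ c ∷ m) (subst (Linked (Edge D)) (cong (λ t → w ∷ c ∷ t) (++-assoc m (v ∷ []) (w ∷ []))) C-linked)
          of λ { (e ∷ _) → e }

    J : Join T (λ a → ⨁ C (λ u → χ u a xor χ w a))
    J = join-walks T-sym C T-connected

    open Join J

    cyc : Fin n → Fin n → Bool
    cyc a b = trail C a b xor edge v w a b

    g : Fin n → Fin n → Bool
    g a b = cyc a b xor f a b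

    g-sym : ∀ a b → g a b ≡ g b a
    g-sym a b = cong₂ _xor_ (cong₂ _xor_ (trail-sym C a b) (edge-sym v w a b)) (f-sym a b)

    g-diag : ∀ a → g a a ≡ false
    g-diag a = cong₂ _xor_ (cong₂ _xor_ (trail-diag C a) (edge-diag v w a)) (f-diag a)

    cyc⇒D : ∀ {a b} → cyc a b ≡ true → Edge D a b
    cyc⇒D {a} {b} e with xor-true {trail C a b} e
    ... | inj₁ t = [ edge-of , D-sym ∘ edge-of ]′ (trail-true⁻¹ C t)
      where
      edge-of : ∀ {x y} → Consecutive C x y → Edge D x y
      edge-of = linked⇒consecutive (linked-++⁻ˡ C C-linked)
    ... | inj₂ t = case edge-true⁻¹ v w a b t of λ { (inj₁ (refl , refl)) → Dvw ; (inj₂ (refl , refl)) → D-sym Dvw }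

    g⇒D : ∀ {a b} → g a b ≡ true → Edge D a b
    g⇒D {a} {b} e = [ cyc⇒D , T⇒D ∘ support ]′ (xor-true {cyc a b} e)

    -- The join consists of edges of T, none of which has both ends in C.
    g-inside : ∀ {a b} → a ∈ C → b ∈ C → g a b ≡ cyc a b
    g-inside {a} {b} a∈ b∈ = trans (cong (cyc a b xor_) (¬-not λ e → T-outside (support e) a∈ b∈)) (xor-identityʳ (cyc a b))

    ∈cs⇒≢w : ∀ {a} → a ∈ cs → a ≢ w
    ∈cs⇒≢w a∈ refl = w∉cs a∈

    g-cs : ∀ {a b} → a ∈ cs → b ∈ cs → g a b ≡ trail cs a b
    g-cs {a} {b} a∈ b∈ = trans (g-inside (there a∈) (there b∈)) (trans
      (cong₂ (λ s t → (s xor trail cs a b) xor t)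
        (edge-false {w} {c} {a} {b} (∈cs⇒≢w a∈ ∘ proj₁) (∈cs⇒≢w b∈ ∘ proj₂))
        (edge-false {v} {w} {a} {b} (∈cs⇒≢w b∈ ∘ proj₂) (∈cs⇒≢w a∈ ∘ proj₁)))
      (xor-identityʳ _))

    g-w : ∀ {a} → a ∈ cs → g a w ≡ edge w c a w xor edge v w a w
    g-w {a} a∈ = trans (g-inside (there a∈) (here refl))
      (cong (_xor edge v w a w) (trans (cong (edge w c a w xor_) (trail-∉ cs w∉cs)) (xor-identityʳ (edge w c a w))))

    -- The closed cycle contributes an even degree everywhere, so only the join counts; away from w
    -- its odd set is C.
    g-degree : ∀ a → a ≢ w → ⨁ V (g a) ≡ does (a ∈? cs)
    g-degree a a≢w = trans (⨁-xor V (cyc a) (f a)) (trans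
      (cong₂ _xor_ (trans (⨁-xor V _ _) (trans (cong₂ _xor_ (trail-degree w (c ∷ m) v a) (edge-degree v w a))
        (trans (xor-telescope (χ w a) (χ v a) (χ w a)) (xor-same (χ w a))))) (degree a))
      (trans (⨁-xor C (λ u → χ u a) (λ _ → χ w a)) (trans (cong₂ _xor_ (⨁-χ a distinct) not-w) (trans (xor-identityʳ _) drop-w))))
      where
      not-w : ⨁ C (λ _ → χ w a) ≡ false
      not-w = trans (⨁-cong C λ _ → dec-false (a ≟ w) a≢w) (⨁-false C)
      drop-w : does (a ∈? C) ≡ does (a ∈? cs)
      drop-w rewrite dec-false (a ≟ w) a≢w = refl

    open Lollipop g g-sym g-diag w v cs (here refl) v∈cs c≢v

    cs-node : Node cs
    cs-node = record
      { uniq = unique-cs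
      ; linked = linked-map-∈ (λ a∈ b∈ k → trans (g-cs a∈ b∈) (trail-consecutive unique-cs k)) (consecutive-linked cs)
      ; end = last-++-∷ (c ∷ m)
      ; avoids = w∉cs
      ; covers = All.tabulate id }

    cs-closes : closes cs ≡ true
    cs-closes = trans (g-w (here refl)) (cong₂ _xor_
      (trans (edge-sym w c c w) (edge-self (∈cs⇒≢w (here refl) ∘ sym)))
      (edge-false {v} {w} {c} {w} (c≢v ∘ proj₁) (∈cs⇒≢w (here refl) ∘ proj₁)))

    -- Closing p through w gives a cycle of D that covers C. As C is longest, p has exactly the
    -- vertices of `cs`, and among these g has only the edges of the path `cs`. The head of p is a
    -- neighbour of w, hence c, and p follows `cs` from there.
    closing⇒cs : ∀ {p} → Node p → closes p ≡ true → p ≡ cs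
    closing⇒cs {p} N cl with node-shape N
    ... | y , x , q , refl = finish (first (xor-true {edge w c y w} (trans (sym (g-w (p⊆cs (here refl)))) cl)))
      where
      open Node N
      cycle′ : IsCycle D (w ∷ p)
      cycle′ = record
        { nonEmpty = λ ()
        ; distinct = ¬Any⇒All¬ _ avoids ∷ uniq
        ; closed = linked⇒closed w p (D-sym (g⇒D cl) ∷
            Linked.++⁺ (Linked.map g⇒D linked) (subst (λ l → Connected (Edge D) l (just w)) (sym end) (just Dvw)) [-]) }

      p≤cs : length p ≤ length cs
      p≤cs = s≤s⁻¹ (proj₂ longest (w ∷ p) cycle′)

      p⊆cs : ∀ {z} → z ∈ p → z ∈ cs
      p⊆cs = unique-⊆-length≥⇒⊇ _≟_ unique-cs uniq (All.lookup covers) p≤cs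

      p≡cs-length : length p ≡ length cs
      p≡cs-length = ≤-antisym p≤cs (unique-⊆⇒length≤ unique-cs (All.lookup covers))

      first : edge w c y w ≡ true ⊎ edge v w y w ≡ true → y ≡ c
      first (inj₁ e) = case edge-true⁻¹ w c y w e of λ
        { (inj₁ (y≡w , _)) → contradiction y≡w (∈cs⇒≢w (p⊆cs (here refl)))
        ; (inj₂ (y≡c , _)) → y≡c }
      first (inj₂ e) = case edge-true⁻¹ v w y w e of λ
        -- The head cannot be v, which is already the last vertex of a path with at least two
        -- vertices.
        { (inj₁ (refl , _)) → contradiction (last-just-∈ (x ∷ q) end) (Unique.Unique[x∷xs]⇒x∉xs uniq)
        ; (inj₂ (y≡w , _)) → contradiction y≡w (∈cs⇒≢w (p⊆cs (here refl))) }

      neighbours : Linked (Neighbours cs) p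
      neighbours = linked-map-∈ (λ a∈ b∈ e → trail-true⁻¹ cs (trans (sym (g-cs (p⊆cs a∈) (p⊆cs b∈))) e)) linked

      finish : y ≡ c → p ≡ cs
      finish refl = cong (y ∷_) (linked-neighbours⇒≡ unique-cs uniq neighbours (suc-injective p≡cs-length))

    -- With `cs` as the only closing node their number would be odd, against `closing-even`.
    impossible : ∀ {ℓ} {X : Set ℓ} → X
    impossible = contradiction (trans (sym only-cs) (closing-even g-degree)) λ ()
      where
      only-cs : ⨁ paths (λ p → does (node? p) ∧ closes p) ≡ true
      only-cs = trans
        (⨁-cong paths λ p → bool-⇔
          (λ e → let np , cl = ∧-true {does (node? p)} e in
                 dec-true (List.≡-dec _≟_ p cs) (closing⇒cs (does-true⇒ (node? p) np) cl))
          (λ e → case does-true⇒ (List.≡-dec _≟_ p cs) e of λ { refl → cong₂ _∧_ (dec-true (node? cs) cs-node) cs-closes }))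
        (⨁-pick (List.≡-dec _≟_) (λ _ → true) (unique-listsUpTo n n) (∈-listsUpTo (unique⇒length≤n unique-cs)))

  Inside : List (Fin n) → Arc n → Set
  Inside C (a , b) = a ∈ C × b ∈ C

  inside? : ∀ C (e : Arc n) → Dec (Inside C e)
  inside? C (a , b) = (a ∈? C) ×-dec (b ∈? C)

  insideArcs : List (Fin n) → Digraph n → List (Arc n)
  insideArcs C H = filter (inside? C) (arcs H)

  ∈-arcs : ∀ {H : Digraph n} {a b} → Edge H a b → (a , b) ∈ arcs H
  ∈-arcs {H} {a} {b} e = ∈-filter⁺ (λ (u , v) → edge? H u v) (∈-cartesianProduct⁺ (∈-allFin a) (∈-allFin b)) e

  arcs-∈ : ∀ {H : Digraph n} {a b} → (a , b) ∈ arcs H → Edge H a b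
  arcs-∈ {H} e∈ = proj₂ (∈-filter⁻ (λ (u , v) → edge? H u v) {xs = cartesianProduct (allFin n) (allFin n)} e∈)

  module _ {H : Digraph n} (H-sc : StronglyConnected H) {C : List (Fin n)} (few : length (insideArcs C H) ≤ 1) where

    Outside : Rel (Fin n) 0ℓ
    Outside a b = (Edge H a b ⊎ Edge H b a) × ¬ Inside C (a , b)

    outside-sym : Symmetric Outside
    outside-sym (e , ¬in) = swap e , λ (b∈ , a∈) → ¬in (a∈ , b∈)

    -- The walk is cut at its first visit to a.
    leave-once : ∀ {a} x → Star (Edge H) x a → Star (λ y z → Edge H y z × y ≢ a) x a
    leave-once x ε = ε
    leave-once {a} x (e ◅ es) with x ≟ a
    ... | yes refl = ε
    ... | no  x≢a  = (e , x≢a) ◅ leave-once _ es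

    -- The one arc a → b inside C is bypassed by a path from b to a that leaves a only at its end.
    outside-connected : ∀ u v → Star Outside u v
    outside-connected u v = kleisliStar id step (H-sc u v)
      where
      step : ∀ {a b} → Edge H a b → Star Outside a b
      step {a} {b} e with inside? C (a , b)
      ... | no ¬in = (inj₁ e , ¬in) ◅ ε
      ... | yes in′ = Star.reverse outside-sym (Star.map bypass (leave-once b (H-sc b a)))
        where
        bypass : ∀ {x y} → Edge H x y × x ≢ a → Outside x y
        bypass (e′ , x≢a) = inj₁ e′ , λ in″ → x≢a (cong proj₁
          (length≤1⇒≡ few (∈-filter⁺ (inside? C) (∈-arcs {H} e′) in″) (∈-filter⁺ (inside? C) (∈-arcs {H} e) in′)))

  -- Three vertices on C provide what rerouting starts from: w and two distinct neighbours c and v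
  -- of it on the cycle.
  two-inside-arcs : ∀ {D H : Digraph n} {C} → Symmetric (Edge D) → IsLongestCycle D C → 2 < length C →
                    IsSCSS D H → 2 ≤ length (insideArcs C H)
  two-inside-arcs {D} {H} {w ∷ c ∷ x ∷ r} D-sym longest _ (H⊆D , H-sc) with ∷-snoc x r
  ... | m , v , eq = decidable-stable (2 ≤? _) λ ¬2≤ →
    let few = s≤s⁻¹ (≰⇒> ¬2≤)
        C≡  = cong (λ t → w ∷ c ∷ t) eq
    in Reroute.impossible D-sym {w} {c} {v} {m} (subst (IsLongestCycle D) C≡ longest)
         (outside-sym H-sc few)
         (λ (e , _) → [ H⊆D , D-sym ∘ H⊆D ]′ e)
         (λ {a} {b} (_ , ¬in) a∈ b∈ → ¬in (subst (a ∈_) (sym C≡) a∈ , subst (b ∈_) (sym C≡) b∈))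
         (λ u → outside-connected H-sc few u w)
  two-inside-arcs {C = []} _ _ ()
  two-inside-arcs {C = _ ∷ []} _ _ (s≤s ())
  two-inside-arcs {C = _ ∷ _ ∷ []} _ _ (s≤s (s≤s ()))

-- Correctness and approximation ratio

length-filter-¬ : ∀ {P : Pred A ℓ} (P? : Unary.Decidable P) xs →
                  length (filter (¬? ∘ P?) xs) + length (filter P? xs) ≡ length xs
length-filter-¬ P? []       = refl
length-filter-¬ P? (x ∷ xs) with P? x
... | yes _ = trans (+-suc _ _) (cong suc (length-filter-¬ P? xs))
... | no  _ = cong suc (length-filter-¬ P? xs)

length-cycleArcs : ∀ {n} (C : List (Fin n)) → length (cycleArcs C) ≡ length C
length-cycleArcs []       = refl
length-cycleArcs (v ∷ vs) = lemma v vs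
  where
  lemma : ∀ {z} x xs → length (zip (x ∷ xs) (xs ∷ʳ z)) ≡ suc (length xs)
  lemma x []       = refl
  lemma x (y ∷ ys) = cong suc (lemma y ys)

arcs-unique : ∀ {n} (H : Digraph n) → Unique (arcs H)
arcs-unique {n} H = Unique.filter⁺ (λ (u , v) → edge? H u v) (Unique.cartesianProduct⁺ (Unique.allFin⁺ n) (Unique.allFin⁺ n))

size-fromArcs : ∀ {n} (F : List (Arc n)) → size (fromArcs F) ≤ length F
size-fromArcs F = unique-⊆⇒length≤ (arcs-unique (fromArcs F)) (arcs-∈ {H = fromArcs F})

fromArcs-SCSS : ∀ {n} {D H : Digraph n} → IsSCSS D H → IsSCSS D (fromArcs (arcs H))
fromArcs-SCSS {H = H} (H⊆D , H-sc) =
  (H⊆D ∘ arcs-∈ {H = H}) , λ u v → Star.map (λ {a} {b} → ∈-arcs {H = H} {a} {b}) (H-sc u v)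

-- Every vertex except `zero` has an arc leaving it on its way to `zero`, and arcs with different
-- tails are different.
order≤1+size : ∀ {n} (H : Digraph n) → StronglyConnected H → n ≤ suc (size H)
order≤1+size {zero}  H H-sc = z≤n
order≤1+size {suc n} H H-sc = s≤s (≤-trans
  (≤-reflexive (sym (trans (length-map leaving (allFin n)) (length-tabulate id))))
  (unique-⊆⇒length≤ (Unique.map⁺ (λ { refl → refl }) (Unique.allFin⁺ n)) leaving-arc))
  where
  out : ∀ i → ∃ λ j → Edge H (suc i) j
  out i with H-sc (suc i) zero
  ... | e ◅ _ = _ , e

  leaving : Fin n → Arc (suc n)
  leaving i = suc i , proj₁ (out i)

  leaving-arc : List.map leaving (allFin n) ⊆ arcs H
  leaving-arc e∈ with ∈-map⁻ leaving e∈
  ... | i , _ , refl = ∈-arcs {H = H} (proj₂ (out i))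

-- Bidirected spanning trees

module SpanningTree {n} {D : Digraph n} (D-sym : Symmetric (Edge D)) (r : Fin n) where

  open DecMembership (_≟_ {n}) using (_∈?_)

  record Tree : Set where
    field
      vertices  : List (Fin n)
      treeArcs  : List (Arc n)
      uniq      : Unique vertices
      tree⊆D    : ∀ {a b} → (a , b) ∈ treeArcs → Edge D a b
      count     : length treeArcs + 2 ≡ 2 * length vertices
      fromRoot  : ∀ {x} → x ∈ vertices → Star (Edge (fromArcs treeArcs)) r x
      toRoot    : ∀ {x} → x ∈ vertices → Star (Edge (fromArcs treeArcs)) x r

  open Tree

  trivial : Tree
  trivial = record
    { vertices = r ∷ [] ; treeArcs = [] ; uniq = [] ∷ [] ; tree⊆D = λ () ; count = refl
    ; fromRoot = λ { (here refl) → ε } ; toRoot = λ { (here refl) → ε } }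

  Extension : Tree → Fin n → Set
  Extension t x = ∃ λ t′ → vertices t ⊆ vertices t′ × x ∈ vertices t′

  attach : ∀ t {u x} → u ∈ vertices t → Edge D u x → Extension t x
  attach t {u} {x} u∈ e with x ∈? vertices t
  ... | yes x∈ = t , id , x∈
  ... | no  x∉ = record
    { vertices = x ∷ vertices t
    ; treeArcs = (u , x) ∷ (x , u) ∷ treeArcs t
    ; uniq = ¬Any⇒All¬ _ x∉ ∷ uniq t
    ; tree⊆D = λ { (here refl) → e ; (there (here refl)) → D-sym e ; (there (there k)) → tree⊆D t k }
    ; count = trans (cong (2 +_) (count t)) (double (length (vertices t)))
    ; fromRoot = λ { (here refl) → Star.map keep (fromRoot t u∈) ◅◅ (here refl ◅ ε)
                   ; (there y∈) → Star.map keep (fromRoot t y∈) }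
    ; toRoot = λ { (here refl) → there (here refl) ◅ Star.map keep (toRoot t u∈)
                 ; (there y∈) → Star.map keep (toRoot t y∈) } } , there , here refl
    where
    keep : ∀ {a b} → (a , b) ∈ treeArcs t → (a , b) ∈ (u , x) ∷ (x , u) ∷ treeArcs t
    keep k = there (there k)
    double : ∀ k → 2 + 2 * k ≡ 2 * suc k
    double = solve-∀

  follow : ∀ t {u x} → u ∈ vertices t → Star (Edge D) u x → Extension t x
  follow t u∈ ε        = t , id , u∈
  follow t u∈ (e ◅ es) =
    let t₁ , t⊆t₁ , y∈ = attach t u∈ e
        t₂ , t₁⊆t₂ , x∈ = follow t₁ y∈ es
    in t₂ , t₁⊆t₂ ∘ t⊆t₁ , x∈

  spanning : StronglyConnected D → ∀ xs → ∃ λ t → r ∈ vertices t × All (_∈ vertices t) xs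
  spanning D-sc []       = trivial , here refl , []
  spanning D-sc (x ∷ xs) =
    let t , r∈ , xs∈ = spanning D-sc xs
        t′ , t⊆t′ , x∈ = follow t r∈ (D-sc r x)
    in t′ , t⊆t′ r∈ , x∈ ∷ All.map t⊆t′ xs∈

-- A spanning tree with both directions of each edge: all vertices reach each other through the root
-- r. Symmetry of `D` supplies the reverse arcs.
sparse-SCSS : ∀ {n} {D : Digraph n} → Symmetric (Edge D) → StronglyConnected D → Fin n →
              ∃ λ H → IsSCSS D H × size H + 2 ≤ 2 * n
sparse-SCSS {n} {D} D-sym D-sc r =
  fromArcs treeArcs , (tree⊆D , λ u v → toRoot (spans u) ◅◅ fromRoot (spans v)) ,
  ≤-trans (+-monoˡ-≤ 2 (size-fromArcs treeArcs)) (≤-trans (≤-reflexive count) (*-monoʳ-≤ 2 (unique⇒length≤n uniq)))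
  where
  open SpanningTree {D = D} D-sym r
  T : ∃ λ t → r ∈ Tree.vertices t × All (_∈ Tree.vertices t) (allFin n)
  T = spanning D-sc (allFin n)
  open Tree (proj₁ T)
  spans : ∀ u → u ∈ vertices
  spans u = All.lookup (proj₂ (proj₂ T)) (∈-allFin u)

-- Contracting a cycle and lifting a solution back

module _ {n m} {C : List (Fin n)} (q : Contraction C m) where

  open Contraction q using (surjective; kernel)

  section : Fin m → Fin n
  section a = proj₁ (surjective a)

  π-section : ∀ a → π q (section a) ≡ a
  π-section a = proj₂ (surjective a) refl

  π-≡ : ∀ {u v} → u ∈ C → v ∈ C → π q u ≡ π q v
  π-≡ u∈ v∈ = Equivalence.from (kernel _ _) (inj₂ (u∈ , v∈))

  contracted-walk : ∀ (D : Digraph n) {u v} → Star (Edge D) u v → Star (Edge (contracted D q)) (π q u) (π q v)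
  contracted-walk D ε = ε
  contracted-walk D {v = v} (_◅_ {i = u} {j = x} e es) with π q u ≟ π q x
  ... | yes eq = subst (λ a → Star (Edge (contracted D q)) a (π q v)) (sym eq) (contracted-walk D es)
  ... | no  ≢  = (≢ , u , x , e , refl , refl) ◅ contracted-walk D es

  contracted-stronglyConnected : ∀ (D : Digraph n) → StronglyConnected D → StronglyConnected (contracted D q)
  contracted-stronglyConnected D D-sc a b = subst₂ (Star (Edge (contracted D q))) (π-section a) (π-section b)
    (contracted-walk D (D-sc (section a) (section b)))

  contracted-symmetric : ∀ (D : Digraph n) → Symmetric (Edge D) → Symmetric (Edge (contracted D q))
  contracted-symmetric D D-sym (a≢b , u , v , e , πu , πv) = a≢b ∘ sym , v , u , D-sym e , πv , πu

  contracted-SCSS : ∀ (D H : Digraph n) → IsSCSS D H → IsSCSS (contracted D q) (contracted H q)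
  contracted-SCSS D H (H⊆D , H-sc) = (λ (a≢b , u , v , e , eqs) → a≢b , u , v , H⊆D e , eqs) , contracted-stronglyConnected H H-sc

  -- Every arc of the contraction is the image of an arc without both ends in C, so the arcs inside
  -- C disappear outright. Merging of parallel arcs makes this an inequality.
  size-contracted : ∀ (H : Digraph n) → size (contracted H q) + length (insideArcs C H) ≤ size H
  size-contracted H = ≤-trans (+-monoˡ-≤ _ fewer) (≤-reflexive (length-filter-¬ (inside? C) (arcs H)))
    where
    outsideArcs : List (Arc n)
    outsideArcs = filter (¬? ∘ inside? C) (arcs H)

    covered : arcs (contracted H q) ⊆ List.map (map (π q) (π q)) outsideArcs
    covered {a , b} e∈ with arcs-∈ {H = contracted H q} e∈
    ... | a≢b , u , v , e , refl , refl = ∈-map⁺ (map (π q) (π q))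
      (∈-filter⁺ (¬? ∘ inside? C) (∈-arcs {H = H} e) λ (u∈ , v∈) → a≢b (π-≡ u∈ v∈))

    fewer : size (contracted H q) ≤ length outsideArcs
    fewer = ≤-trans (unique-⊆⇒length≤ (arcs-unique (contracted H q)) covered)
                    (≤-reflexive (length-map (map (π q) (π q)) outsideArcs))

  -- C followed by one preimage of each vertex other than the contracted one is a duplicate-free
  -- list of old vertices.
  order-contracted : ∀ {c} → c ∈ C → Unique C → m + length C ≤ suc n
  order-contracted {c} c∈ uC = ≤-trans (+-monoˡ-≤ (length C) m≤) (≤-trans (≤-reflexive total) (s≤s (unique⇒length≤n unique)))
    where
    others : List (Fin m)
    others = filter (λ a → ¬? (a ≟ π q c)) (allFin m)

    m≤ : m ≤ suc (length others)
    m≤ = ≤-trans (≤-reflexive (sym (length-tabulate {n = m} id)))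
      (unique-⊆⇒length≤ {ys = π q c ∷ others} (Unique.allFin⁺ m) λ {a} _ → split a)
      where
      split : ∀ a → a ∈ π q c ∷ others
      split a with a ≟ π q c
      ... | yes refl = here refl
      ... | no  a≢   = there (∈-filter⁺ (λ a → ¬? (a ≟ π q c)) (∈-allFin a) a≢)

    unique : Unique (C ++ List.map section others)
    unique = Unique.++⁺ uC
      (Unique.map⁺ (λ eq → trans (sym (π-section _)) (trans (cong (π q) eq) (π-section _)))
                   (Unique.filter⁺ (λ a → ¬? (a ≟ π q c)) (Unique.allFin⁺ m)))
      λ (x∈C , x∈s) → case ∈-map⁻ section x∈s of λ { (a , a∈ , refl) →
        proj₂ (∈-filter⁻ (λ a → ¬? (a ≟ π q c)) {xs = allFin m} a∈) (trans (sym (π-section a)) (π-≡ x∈C c∈)) }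

    total : suc (length others) + length C ≡ suc (length (C ++ List.map section others))
    total = cong suc (trans (+-comm (length others) (length C))
      (sym (trans (length-++ C) (cong (length C +_) (length-map section others)))))

cycle-connected : ∀ {n} {C : List (Fin n)} {u v} → u ∈ C → v ∈ C → Star (λ a b → (a , b) ∈ cycleArcs C) u v
cycle-connected {C = w ∷ cs} u∈ v∈ = toEnd w cs around u∈ ◅◅ fromStart w cs around v∈
  where
  around : Linked (λ a b → (a , b) ∈ cycleArcs (w ∷ cs)) (w ∷ cs ∷ʳ w)
  around = closed⇒linked w cs (All.tabulate id)

  fromStart : ∀ {R : Rel A ℓ} x xs {y z} → Linked R (x ∷ xs ∷ʳ z) → y ∈ x ∷ xs → Star R x y
  fromStart x xs       k       (here refl) = ε
  fromStart x (y ∷ ys) (e ∷ k) (there u∈)  = e ◅ fromStart y ys k u∈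

  toEnd : ∀ {R : Rel A ℓ} x xs {y z} → Linked R (x ∷ xs ∷ʳ z) → y ∈ x ∷ xs → Star R y z
  toEnd x []       (e ∷ k) (here refl) = e ◅ ε
  toEnd x (y ∷ ys) (e ∷ k) (here refl) = e ◅ toEnd y ys k (here refl)
  toEnd x (y ∷ ys) (e ∷ k) (there u∈)  = toEnd y ys k u∈

module _ {n m} {C : List (Fin n)} (D : Digraph n) (q : Contraction C m) where

  lifts-edge : ∀ {F F′} → Lifts D q F F′ → ∀ {e} → e ∈ F → uncurry (Edge D) e
  lifts-edge ((e , _) ∷ _)  (here refl) = e
  lifts-edge (_ ∷ lifts)    (there e∈)  = lifts-edge lifts e∈

  lifts-preimage : ∀ {F F′} → Lifts D q F F′ → ∀ {e′} → e′ ∈ F′ → ∃ λ e → e ∈ F × map (π q) (π q) e ≡ e′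
  lifts-preimage (_∷_ {x = e} (_ , eq) _) (here refl) = e , here refl , eq
  lifts-preimage (_ ∷ lifts) (there e∈) = let e , e∈F , eq = lifts-preimage lifts e∈ in e , there e∈F , eq

  length-contract : ∀ {F F′} → Lifts D q F F′ → length C + length F′ ≡ length (cycleArcs C ++ F)
  length-contract lifts = sym (trans (length-++ (cycleArcs C)) (cong₂ _+_ (length-cycleArcs C) (Pointwise-length lifts)))

-- Walks are lifted arc by arc. Where one lifted arc ends and the next begins, the two vertices have
-- the same image under `π`, so they are equal or joined along the cycle.
uncontract-SCSS : ∀ {n m} {D : Digraph n} {C F F′} (q : Contraction C m) → IsCycle D C → Lifts D q F F′ →
                  IsSCSS (contracted D q) (fromArcs F′) → IsSCSS D (fromArcs (cycleArcs C ++ F))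
uncontract-SCSS {n} {m} {D} {C} {F} {F′} q cycle lifts (_ , F′-sc) =
  (λ e∈ → [ All.lookup (IsCycle.closed cycle) , lifts-edge D q lifts ]′ (∈-++⁻ (cycleArcs C) e∈)) ,
  λ u v → lift-walk u (F′-sc (π q u) (π q v)) refl refl
  where
  R : Rel (Fin n) 0ℓ
  R = Edge (fromArcs (cycleArcs C ++ F))

  fibre : ∀ u v → π q u ≡ π q v → Star R u v
  fibre u v eq with Equivalence.to (Contraction.kernel q u v) eq
  ... | inj₁ refl      = ε
  ... | inj₂ (u∈ , v∈) = Star.map ∈-++⁺ˡ (cycle-connected u∈ v∈)

  lift-walk : ∀ {a b v} u → Star (Edge (fromArcs F′)) a b → π q u ≡ a → π q v ≡ b → Star R u v
  lift-walk u ε         πu πv = fibre u _ (trans πu (sym πv))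
  lift-walk u (e′∈ ◅ es) πu πv with lifts-preimage D q lifts e′∈
  ... | (x , y) , e∈ , eq =
    fibre u x (trans πu (sym (cong proj₁ eq))) ◅◅ (∈-++⁺ʳ (cycleArcs C) e∈ ◅ lift-walk y es (cong proj₂ eq) πv)

phase₂-SCSS : ∀ {n} {D : Digraph n} {F} → Phase₂ D F → IsSCSS D (fromArcs F)
phase₂-SCSS {D = D} (solve {H = H} _ (H-scss , _)) = fromArcs-SCSS {D = D} {H} H-scss
phase₂-SCSS (contract (cycle , _) _ q run lifts) = uncontract-SCSS q cycle lifts (phase₂-SCSS run)

khuller-SCSS : ∀ {k n} {D : Digraph n} {F} → Khuller k D F → IsSCSS D (fromArcs F)
khuller-SCSS (contract cycle _ q run lifts) = uncontract-SCSS q cycle lifts (khuller-SCSS run)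
khuller-SCSS (phase₂ _ run) = phase₂-SCSS run

-- A run on n vertices returns f arcs, against a subgraph of size o.  A cycle of length l adds 23 l to the
-- left side; contracting it lowers the right side by 24 (l - 1) and by 11 for each arc of the subgraph
-- inside the cycle.
Bound : ℕ → ℕ → ℕ → Set
Bound n f o = 23 * f + 24 ≤ 24 * n + 11 * o

-- The hypothesis `24 ≤ l + 11 * g` is 23 l ≤ 24 (l - 1) + 11 g without subtraction. It covers both
-- phases: l ≥ 24, or g ≥ 2 with l ≥ 2.
bound-contract : ∀ n m l f o o′ g → m + l ≤ suc n → o′ + g ≤ o → 24 ≤ l + 11 * g → Bound m f o′ → Bound n (l + f) o
bound-contract n m l f o o′ g m+l≤ o′+g≤ 24≤ bound = +-cancelʳ-≤ 24 _ _ (begin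
  23 * (l + f) + 24 + 24                    ≡⟨ e₁ l f ⟩
  23 * l + (23 * f + 24) + 24               ≤⟨ +-mono-≤ (+-monoʳ-≤ (23 * l) bound) 24≤ ⟩
  23 * l + (24 * m + 11 * o′) + (l + 11 * g) ≡⟨ e₂ l m o′ g ⟩
  24 * (m + l) + 11 * (o′ + g)              ≤⟨ +-mono-≤ (*-monoʳ-≤ 24 m+l≤) (*-monoʳ-≤ 11 o′+g≤) ⟩
  24 * suc n + 11 * o                       ≡⟨ e₃ n o ⟩
  24 * n + 11 * o + 24                      ∎)
  where
  open ≤-Reasoning
  e₁ : ∀ l f → 23 * (l + f) + 24 + 24 ≡ 23 * l + (23 * f + 24) + 24
  e₁ = solve-∀
  e₂ : ∀ l m o′ g → 23 * l + (24 * m + 11 * o′) + (l + 11 * g) ≡ 24 * (m + l) + 11 * (o′ + g)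
  e₂ = solve-∀
  e₃ : ∀ n o → 24 * suc n + 11 * o ≡ 24 * n + 11 * o + 24
  e₃ = solve-∀

-- The weight 23 is split as 12 + 11: twelve parts are paid by s ≤ 2 (n - 1), which gives 24 per
-- vertex, and eleven by s ≤ o.
bound-solve : ∀ n s o → s + 2 ≤ 2 * n → s ≤ o → Bound n s o
bound-solve n s o s+2≤ s≤o = begin
  23 * s + 24             ≡⟨ e₁ s ⟩
  12 * (s + 2) + 11 * s   ≤⟨ +-mono-≤ (*-monoʳ-≤ 12 s+2≤) (*-monoʳ-≤ 11 s≤o) ⟩
  12 * (2 * n) + 11 * o   ≡⟨ e₂ n o ⟩
  24 * n + 11 * o         ∎
  where
  open ≤-Reasoning
  e₁ : ∀ s → 23 * s + 24 ≡ 12 * (s + 2) + 11 * s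
  e₁ = solve-∀
  e₂ : ∀ n o → 12 * (2 * n) + 11 * o ≡ 24 * n + 11 * o
  e₂ = solve-∀

cycle-vertex : ∀ {n} {D : Digraph n} {C} → IsCycle D C → ∃ λ c → c ∈ C
cycle-vertex {C = []}    cycle = contradiction refl (IsCycle.nonEmpty cycle)
cycle-vertex {C = c ∷ _} cycle = c , here refl

contract-bound : ∀ {n m} {D : Digraph n} {C F F′} (q : Contraction C m) → IsCycle D C → Lifts D q F F′ →
                 ∀ O → 24 ≤ length C + 11 * length (insideArcs C O) →
                 Bound m (length F′) (size (contracted O q)) → Bound n (length (cycleArcs C ++ F)) (size O)
contract-bound {n} {m} {D} {C} {F} {F′} q cycle lifts O 24≤ bound =
  subst (λ f → Bound n f (size O)) (length-contract D q lifts)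
    (bound-contract n m (length C) (length F′) (size O) (size (contracted O q)) (length (insideArcs C O))
      (order-contracted q (proj₂ (cycle-vertex cycle)) (IsCycle.distinct cycle)) (size-contracted q O) 24≤ bound)

-- The induction runs over all strongly connected spanning subgraphs O, because the image of a
-- minimum one under contraction need not stay minimum. The vertex r is the root for the spanning
-- tree of the final graph.
phase₂-bound : ∀ {n} {D : Digraph n} {F} → Symmetric (Edge D) → StronglyConnected D → Fin n → Phase₂ D F →
               ∀ O → IsSCSS D O → Bound n (length F) (size O)
phase₂-bound {n} {D} D-sym D-sc r (solve {H = H} _ (_ , minimal)) O O-scss =
  let H′ , H′-scss , H′≤ = sparse-SCSS {D = D} D-sym D-sc r
  in bound-solve n (size H) (size O) (≤-trans (+-monoˡ-≤ 2 (minimal H′ H′-scss)) H′≤) (minimal O O-scss)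
phase₂-bound {n} {D} D-sym D-sc r (contract {C = C} C-longest@(cycle , _) 3<C q run lifts) O O-scss =
  contract-bound q cycle lifts O
    -- 24 = 2 + 11 * 2: at least two vertices on C, and two arcs of O inside it.
    (+-mono-≤ {2} (≤-trans (s≤s (s≤s z≤n)) 3<C)
      (*-monoʳ-≤ 11 (two-inside-arcs {D = D} {O} D-sym C-longest (≤-trans (s≤s (s≤s (s≤s z≤n))) 3<C) O-scss)))
    (phase₂-bound (contracted-symmetric q D D-sym) (contracted-stronglyConnected q D D-sc) (π q r) run
      (contracted O q) (contracted-SCSS q D O O-scss))

khuller-bound : ∀ {n} {D : Digraph n} {F} → Symmetric (Edge D) → StronglyConnected D → Fin n → Khuller 24 D F →
                ∀ O → IsSCSS D O → Bound n (length F) (size O)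
khuller-bound {n} {D} D-sym D-sc r (contract {C = C} cycle 24≤C q run lifts) O O-scss =
  contract-bound q cycle lifts O (≤-trans 24≤C (m≤m+n _ _))
    (khuller-bound (contracted-symmetric q D D-sym) (contracted-stronglyConnected q D D-sc) (π q r) run
      (contracted O q) (contracted-SCSS q D O O-scss))
khuller-bound D-sym D-sc r (phase₂ _ run) O O-scss = phase₂-bound D-sym D-sc r run O O-scss

-- Replacing n by size O + 1 gives 24 + 11 = 35 per arc of O, and the additional 24 cancels the one
-- kept in `Bound`.
approximation : ∀ {n} {D : Digraph n} {F} → Symmetric (Edge D) → StronglyConnected D → Khuller 24 D F →
                ∀ O → IsSCSS D O → 23 * size (fromArcs F) ≤ 35 * size O
approximation {zero}  _ _ _ _ _ = z≤n
approximation {suc n} {F = F} D-sym D-sc run O O-scss = +-cancelʳ-≤ 24 _ _ (begin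
  23 * size (fromArcs F) + 24        ≤⟨ +-monoˡ-≤ 24 (*-monoʳ-≤ 23 (size-fromArcs F)) ⟩
  23 * length F + 24                 ≤⟨ khuller-bound D-sym D-sc zero run O O-scss ⟩
  24 * suc n + 11 * size O           ≤⟨ +-monoˡ-≤ (11 * size O) (*-monoʳ-≤ 24 (order≤1+size O (proj₂ O-scss))) ⟩
  24 * suc (size O) + 11 * size O    ≡⟨ e (size O) ⟩
  35 * size O + 24                   ∎)
  where
  open ≤-Reasoning
  e : ∀ o → 24 * suc o + 11 * o ≡ 35 * o + 24
  e = solve-∀

-- Existence of a run

module Reachability {n} {R : Rel (Fin n) 0ℓ} (R? : Decidable R) where

  -- Warshall: Via xs u v asks for a walk whose inner vertices belong to xs.
  Via : List (Fin n) → Rel (Fin n) 0ℓ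
  Via []       u v = u ≡ v ⊎ R u v
  Via (x ∷ xs) u v = Via xs u v ⊎ (Via xs u x × Via xs x v)

  via? : ∀ xs → Decidable (Via xs)
  via? []       u v = (u ≟ v) ⊎-dec R? u v
  via? (x ∷ xs) u v = via? xs u v ⊎-dec (via? xs u x ×-dec via? xs x v)

  via⇒walk : ∀ xs {u v} → Via xs u v → Star R u v
  via⇒walk []       (inj₁ refl)    = ε
  via⇒walk []       (inj₂ e)       = e ◅ ε
  via⇒walk (x ∷ xs) (inj₁ k)       = via⇒walk xs k
  via⇒walk (x ∷ xs) (inj₂ (k , l)) = via⇒walk xs k ◅◅ via⇒walk xs l

  via-base : ∀ xs {u v} → u ≡ v ⊎ R u v → Via xs u v
  via-base []       k = k
  via-base (x ∷ xs) k = inj₁ (via-base xs k)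

  -- Detours are cut out: when both parts pass through y, the excursion from y to x and back is
  -- dropped, so no inner vertex is used at two levels.
  via-trans : ∀ xs {u x v} → x ∈ xs → Via xs u x → Via xs x v → Via xs u v
  via-trans (x ∷ xs) (here refl) k l = inj₂ (last-visit k , first-visit l)
    where
    last-visit : ∀ {u} → Via (x ∷ xs) u x → Via xs u x
    last-visit = [ id , proj₁ ]′
    first-visit : ∀ {v} → Via (x ∷ xs) x v → Via xs x v
    first-visit = [ id , proj₂ ]′
  via-trans (y ∷ xs) (there x∈) (inj₁ k)       (inj₁ l)       = inj₁ (via-trans xs x∈ k l)
  via-trans (y ∷ xs) (there x∈) (inj₁ k)       (inj₂ (l , m)) = inj₂ (via-trans xs x∈ k l , m)
  via-trans (y ∷ xs) (there x∈) (inj₂ (k , l)) (inj₁ m)       = inj₂ (k , via-trans xs x∈ l m)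
  via-trans (y ∷ xs) (there x∈) (inj₂ (k , _)) (inj₂ (_ , m)) = inj₂ (k , m)

  walk⇒via : ∀ {u v} → Star R u v → Via (allFin n) u v
  walk⇒via ε        = via-base (allFin n) (inj₁ refl)
  walk⇒via (e ◅ es) = via-trans (allFin n) (∈-allFin _) (via-base (allFin n) (inj₂ e)) (walk⇒via es)

  reachable? : Decidable (Star R)
  reachable? u v = map′ (via⇒walk (allFin n)) walk⇒via (via? (allFin n) u v)

stronglyConnected? : ∀ {n} (D : Digraph n) → Dec (StronglyConnected D)
stronglyConnected? D = all? λ u → all? λ v → Reachability.reachable? (edge? D) u v

sublists : List A → List (List A)
sublists []       = [] ∷ []
sublists (x ∷ xs) = List.map (x ∷_) (sublists xs) ++ sublists xs

filter∈sublists : ∀ {P : Pred A ℓ} (P? : ∀ x → Dec (P x)) xs → filter P? xs ∈ sublists xs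
filter∈sublists P? []       = here refl
filter∈sublists P? (x ∷ xs) with P? x
... | yes _ = ∈-++⁺ˡ (∈-map⁺ (x ∷_) (filter∈sublists P? xs))
... | no  _ = ∈-++⁺ʳ (List.map (x ∷_) (sublists xs)) (filter∈sublists P? xs)

-- Edge relations are arbitrary and cannot be enumerated, but any H may be replaced by
-- `fromArcs (arcs H)`, and `arcs H` is a sublist of the list of all pairs. The search runs over
-- these sublists.
minimum-SCSS : ∀ {n} (D : Digraph n) → StronglyConnected D → ∃ λ H → IsMinimumSCSS D H
minimum-SCSS {n} D D-sc = fromArcs best , best-scss , best-minimal
  where
  Good : List (Arc n) → Set
  Good F = All (uncurry (Edge D)) F × StronglyConnected (fromArcs F)

  good? : ∀ F → Dec (Good F)
  good? F = All.all? (λ (u , v) → edge? D u v) F ×-dec stronglyConnected? (fromArcs F)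

  good⇒SCSS : ∀ {F} → Good F → IsSCSS D (fromArcs F)
  good⇒SCSS (F⊆D , F-sc) = All.lookup F⊆D , F-sc

  SCSS⇒good : ∀ {F} → IsSCSS D (fromArcs F) → Good F
  SCSS⇒good (F⊆D , F-sc) = All.tabulate F⊆D , F-sc

  pairs : List (Arc n)
  pairs = cartesianProduct (allFin n) (allFin n)

  candidates : List (List (Arc n))
  candidates = filter good? (sublists pairs)

  cost : List (Arc n) → ℕ
  cost F = size (fromArcs F)

  best : List (Arc n)
  -- The default `arcs D` is admissible because D is itself strongly connected.
  best = argmin cost (arcs D) candidates

  best-scss : IsSCSS D (fromArcs best)
  best-scss = good⇒SCSS (argmin-all cost (SCSS⇒good (fromArcs-SCSS {D = D} {D} (id , D-sc))) (all-filter good? (sublists pairs)))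

  best-minimal : ∀ H → IsSCSS D H → cost best ≤ size H
  best-minimal H H-scss = ≤-trans
    (All.lookup (f[argmin]≤f[xs] {f = cost} (arcs D) candidates)
      (∈-filter⁺ good? (filter∈sublists (λ (u , v) → edge? H u v) pairs) (SCSS⇒good (fromArcs-SCSS {D = D} {H} H-scss))))
    (size-fromArcs (arcs H))

module _ {n} (D : Digraph n) where

  isCycle? : ∀ C → Dec (IsCycle D C)
  isCycle? []        = no λ c → IsCycle.nonEmpty c refl
  isCycle? C@(_ ∷ _) = map′ (λ (u , c) → record { nonEmpty = λ () ; distinct = u ; closed = c })
                            (λ c → IsCycle.distinct c , IsCycle.closed c)
    (DecUnique.unique? _≟_ C ×-dec All.all? (λ (u , v) → edge? D u v) (cycleArcs C))

  cycles : List (List (Fin n))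
  cycles = filter isCycle? (listsUpTo n n)

  ∈-cycles : ∀ {C} → IsCycle D C → C ∈ cycles
  ∈-cycles c = ∈-filter⁺ isCycle? (∈-listsUpTo (unique⇒length≤n (IsCycle.distinct c))) c

  cycle≥? : ∀ k → Dec (∃ λ C → IsCycle D C × k ≤ length C)
  cycle≥? k = map′
    (λ any → let C , C∈ , k≤ = find any in C , proj₂ (∈-filter⁻ isCycle? {xs = listsUpTo n n} C∈) , k≤)
    (λ (C , c , k≤) → lose (∈-cycles c) k≤)
    (Any.any? (λ C → k ≤? length C) cycles)

  longest-cycle : ∀ {C} → IsCycle D C → ∃ λ C′ → IsLongestCycle D C′ × length C ≤ length C′
  longest-cycle {C} c = C′ , (argmax-all length c (all-filter isCycle? (listsUpTo n n)) , λ _ → longest) , longest c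
    where
    C′ : List (Fin n)
    C′ = argmax length C cycles
    longest : ∀ {C″} → IsCycle D C″ → length C″ ≤ length C′
    longest c″ = All.lookup (f[xs]≤f[argmax] C cycles) (∈-cycles c″)

unique-lookup-injective : ∀ {xs : List A} → Unique xs → ∀ i j → lookup xs i ≡ lookup xs j → i ≡ j
unique-lookup-injective {xs = _ ∷ _} u zero zero eq = refl
unique-lookup-injective {xs = _ ∷ xs} u zero (suc j) eq = contradiction (subst (_∈ xs) (sym eq) (∈-lookup j)) (Unique.Unique[x∷xs]⇒x∉xs u)
unique-lookup-injective {xs = _ ∷ xs} u (suc i) zero eq = contradiction (subst (_∈ xs) eq (∈-lookup i)) (Unique.Unique[x∷xs]⇒x∉xs u)
unique-lookup-injective {xs = _ ∷ _} (_ ∷ u) (suc i) (suc j) eq = cong suc (unique-lookup-injective u i j eq)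

-- Each class gets a representative, c for C and the vertex itself off C; the new vertices are the
-- positions in the list of representatives.
contraction : ∀ {n} {C : List (Fin n)} {c} → c ∈ C → ∃ λ m → Contraction C m
contraction {n} {C} {c} c∈ = length reps , record
  { π = class
  ; surjective = λ i → lookup reps i , λ { refl → class-lookup i }
  ; kernel = λ u v → mk⇔ (rep-≡⁻¹ u v ∘ class-≡⁻¹ u v) (λ eq → class-≡ u v (rep-≡ u v eq)) }
  where
  open DecMembership (_≟_ {n}) using (_∈?_)

  rep : Fin n → Fin n
  rep u with u ∈? C
  ... | yes _ = c
  ... | no  _ = u

  rep-∈ : ∀ {u} → u ∈ C → rep u ≡ c
  rep-∈ {u} u∈ with u ∈? C
  ... | yes _  = refl
  ... | no  u∉ = contradiction u∈ u∉

  rep-≡ : ∀ u v → u ≡ v ⊎ (u ∈ C × v ∈ C) → rep u ≡ rep v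
  rep-≡ u v (inj₁ refl)      = refl
  rep-≡ u v (inj₂ (u∈ , v∈)) = trans (rep-∈ u∈) (sym (rep-∈ v∈))

  rep-≡⁻¹ : ∀ u v → rep u ≡ rep v → u ≡ v ⊎ (u ∈ C × v ∈ C)
  rep-≡⁻¹ u v eq with u ∈? C | v ∈? C
  ... | yes u∈ | yes v∈ = inj₂ (u∈ , v∈)
  ... | no  _  | no  _  = inj₁ eq
  ... | yes _  | no  v∉ = contradiction (subst (_∈ C) eq c∈) v∉
  ... | no  u∉ | yes _  = contradiction (subst (_∈ C) (sym eq) c∈) u∉

  rep-idem : ∀ u → rep (rep u) ≡ rep u
  rep-idem u with u ∈? C
  ... | yes _  = rep-∈ c∈
  ... | no  u∉ with u ∈? C
  ...   | yes u∈ = contradiction u∈ u∉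
  ...   | no  _  = refl

  isRep? : ∀ u → Dec (rep u ≡ u)
  isRep? u = rep u ≟ u

  reps : List (Fin n)
  reps = filter isRep? (allFin n)

  rep∈reps : ∀ u → rep u ∈ reps
  rep∈reps u = ∈-filter⁺ isRep? (∈-allFin (rep u)) (rep-idem u)

  class : Fin n → Fin (length reps)
  class u = Any.index (rep∈reps u)

  lookup-class : ∀ u → lookup reps (class u) ≡ rep u
  lookup-class u = sym (lookup-index (rep∈reps u))

  class-≡⁻¹ : ∀ u v → class u ≡ class v → rep u ≡ rep v
  class-≡⁻¹ u v eq = trans (sym (lookup-class u)) (trans (cong (lookup reps) eq) (lookup-class v))

  unique-reps : Unique reps
  unique-reps = Unique.filter⁺ isRep? (Unique.allFin⁺ n)

  class-≡ : ∀ u v → rep u ≡ rep v → class u ≡ class v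
  class-≡ u v eq = unique-lookup-injective unique-reps _ _ (trans (lookup-class u) (trans eq (sym (lookup-class v))))

  class-lookup : ∀ i → class (lookup reps i) ≡ i
  class-lookup i = unique-lookup-injective unique-reps _ _
    (trans (lookup-class (lookup reps i)) (proj₂ (∈-filter⁻ isRep? {xs = allFin n} (∈-lookup i))))

lift-arcs : ∀ {n m} {C : List (Fin n)} (D : Digraph n) (q : Contraction C m) {F′} →
            All (uncurry (Edge (contracted D q))) F′ → ∃ λ F → Lifts D q F F′
lift-arcs D q []                                    = [] , []
lift-arcs D q ((_ , u , v , e , refl , refl) ∷ es) = let F , lifts = lift-arcs D q es in (u , v) ∷ F , (e , refl) ∷ lifts

contraction-smaller : ∀ {n m} {C : List (Fin n)} {c} (q : Contraction C m) → c ∈ C → Unique C → 2 ≤ length C → m < n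
contraction-smaller {n} {m} {C} q c∈ u 2≤ = +-cancelʳ-≤ 1 _ _
  (≤-trans (≤-reflexive (two m)) (≤-trans (≤-trans (+-monoʳ-≤ m 2≤) (order-contracted q c∈ u)) (≤-reflexive (+-comm 1 n))))
  where
  two : ∀ m → suc m + 1 ≡ m + 2
  two m = trans (cong suc (+-comm m 1)) (+-comm 2 m)

-- Contracting a cycle of length at least 2 lowers the number of vertices, which gives termination.
-- The result of the recursive run can be lifted because correctness already places it inside the
-- contracted graph.
phase₂-exists : ∀ {n} (D : Digraph n) → StronglyConnected D → Acc _<_ n → ∃ (Phase₂ D)
phase₂-exists D D-sc (acc smaller) with cycle≥? D 4
... | no none = let H , H-min = minimum-SCSS D D-sc in
  arcs H , solve (λ C c → s≤s⁻¹ (≰⇒> λ 4≤ → none (C , c , 4≤))) H-min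
... | yes (_ , c₀ , 4≤) =
  let C , longest@(c , _) , len = longest-cycle D c₀
      4≤C = ≤-trans 4≤ len
      c∈ = proj₂ (cycle-vertex c)
      m , q = contraction c∈
      F′ , run = phase₂-exists (contracted D q) (contracted-stronglyConnected q D D-sc)
                   (smaller (contraction-smaller q c∈ (IsCycle.distinct c) (≤-trans (s≤s (s≤s z≤n)) 4≤C)))
      F , lifts = lift-arcs D q (All.tabulate (proj₁ (phase₂-SCSS run)))
  in _ , contract longest 4≤C q run lifts

-- The condition `2 ≤ k` makes every contraction shrink the graph; contracting a single vertex would
-- not.
khuller-exists : ∀ {n} k (D : Digraph n) → 2 ≤ k → StronglyConnected D → Acc _<_ n → ∃ (Khuller k D)
khuller-exists {n} k D 2≤k D-sc (acc smaller) with cycle≥? D k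
... | no none = let F , run = phase₂-exists D D-sc (<-wellFounded n) in F , phase₂ (λ C c k≤ → none (C , c , k≤)) run
... | yes (C , c , k≤) =
  let c∈ = proj₂ (cycle-vertex c)
      m , q = contraction c∈
      F′ , run = khuller-exists k (contracted D q) 2≤k (contracted-stronglyConnected q D D-sc)
                   (smaller (contraction-smaller q c∈ (IsCycle.distinct c) (≤-trans 2≤k k≤)))
      F , lifts = lift-arcs D q (All.tabulate (proj₁ (khuller-SCSS run)))
  in _ , contract c k≤ q run lifts

corollary4p3 : ∀ {n : ℕ} (D : Digraph n) → StronglyConnected D → Symmetric (Edge D) →
    ∃ (λ F → Khuller 24 D F) ×
    (∀ F → Khuller 24 D F →
    IsSCSS D (fromArcs F) ×
    (∀ O → IsMinimumSCSS D O → 23 * size (fromArcs F) ≤ 35 * size O))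
corollary4p3 {n} D D-sc D-sym =
  khuller-exists 24 D (s≤s (s≤s z≤n)) D-sc (<-wellFounded n) ,
  λ F run → khuller-SCSS run , λ O (O-scss , _) → approximation D-sym D-sc run O O-scss
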